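{- Let $k\ge 2$ be an integer and let $n=2k-1$. Then the adjacency spectrum of the line graph $L(BL_n(k-1,k))$ consists of exactly the following eigenvalues with the following multiplicities: \begin{itemize} \item $-2$, with multiplicity $(k-2)\binom{2k-1}{k-1}+1$; \item $i-2$, for each $i=1,2,\ldots,k-1$, with multiplicity $\binom{2k-1}{i}-\binom{2k-1}{i-1}$; \item $2k-i-2$, for each $i=0,1,\ldots,k-1$, with multiplicity $\binom{2k-1}{i}-\binom{2k-1}{i-1}$. \end{itemize}
   Context: Let $[n]=\{1,\ldots,n\}$. For $n\ge 3$, the Boolean lattice $BL_n$ is the graph whose vertices are all subsets of $[n]$, two subsets being adjacent if and only if their symmetric difference has exactly one element. $BL_n(k-1,k)$ is the induced subgraph of $BL_n$ on the set of all $(k-1)$-element subsets and all $k$-element subsets of $[n]$; that is, it is the bipartite graph in which a $(k-1)$-subset $U$ is adjacent to a $k$-subset $W$ if and only if $U\subset W$. The line graph $L(\Gamma)$ of a graph $\Gamma$ has as vertices the edges of $\Gamma$, two distinct edges being adjacent if and only if they share an endpoint. The spectrum of a graph is the multiset of eigenvalues of its adjacency matrix. Convention: $\binom{n}{ -1}=0$. -}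

module Defs where

open import Algebra.Bundles.Raw using (RawRing)
import Algebra.Definitions.RawSemiring as RawSemiringDefinitions
open import Data.Bool.Base using (if_then_else_)
open import Data.Empty using (⊥)
open import Data.Fin.Base using (Fin; zero; suc; toℕ)
import Data.Fin.Properties as Fin
open import Data.Fin.Subset using (Subset; inside; outside; _∪_; _─_; ∣_∣)
open import Data.Integer.Base as ℤ using (ℤ; +_; -[1+_]; 0ℤ; 1ℤ)
open import Data.List.Base using (List; []; _∷_; _++_; map; filter; foldr; length; lookup)
open import Data.List.Membership.Propositional using (_∈_)
open import Data.List.Membership.Propositional.Properties using (∈-map⁺; ∈-map⁻; ∈-++⁺ˡ; ∈-++⁺ʳ; ∈-++⁻)
import Data.List.Relation.Unary.All as All
open import Data.List.Relation.Unary.AllPairs using ([]; _∷_)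
open import Data.List.Relation.Unary.Any using (here; there)
open import Data.List.Relation.Unary.Unique.Propositional using (Unique)
import Data.List.Relation.Unary.Unique.Propositional.Properties as Unique
open import Data.Nat.Base using (ℕ; zero; suc)
import Data.Nat.Properties as ℕ
open import Data.Nat.Combinatorics using (_C_)
open import Data.Product.Base using (_×_; _,_; proj₁; proj₂)
open import Data.Product.Properties using (≡-dec; ,-injectiveʳ)
open import Data.Sum.Base using (_⊎_; inj₁; inj₂)
open import Data.Vec.Base using ([]; _∷_)
open import Data.Vec.Functional using (removeAt)
import Data.Vec.Properties as Vec
import Data.Bool.Properties as Bool
open import Level using (0ℓ)
open import Relation.Binary.Core using (Rel)
open import Relation.Binary.Definitions using (Decidable; DecidableEquality; Symmetric)
open import Relation.Binary.PropositionalEquality using (_≡_; _≢_; refl; sym; trans; cong)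
open import Relation.Nullary.Decidable using (does; ¬?; _×-dec_; _⊎-dec_)
open import Relation.Nullary.Negation using (¬_)
import Relation.Unary as U

-- Finite simple graphs.  The vertex set is the duplicate-free list `vertices`
-- of elements of the ambient type `V`; what `Adj` says about elements of `V`
-- that are not listed is irrelevant.  The order of the list serves only to
-- index the adjacency matrix and to choose one representative for each
-- unordered pair of vertices.

record Graph : Set₁ where
  field
    V          : Set
    _≟_        : DecidableEquality V
    vertices   : List V
    unique     : Unique vertices
    Adj        : Rel V 0ℓ
    adj?       : Decidable Adj
    Adj-sym    : Symmetric Adj
    Adj-irrefl : ∀ {v} → ¬ Adj v v

  order : ℕ
  order = length vertices

induced : (Γ : Graph) {P : U.Pred (Graph.V Γ) 0ℓ} → U.Decidable P → Graph
induced Γ P? = record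
  { Graph Γ hiding (vertices; unique; order)
  ; vertices = filter P? (Graph.vertices Γ)
  ; unique   = Unique.filter⁺ P? (Graph.unique Γ)
  }

module _ (Γ : Graph) where
  open Graph Γ

  edgesAmong : List V → List (V × V)
  edgesAmong []       = []
  edgesAmong (v ∷ vs) = map (v ,_) (filter (adj? v) vs) ++ edgesAmong vs

  private
    edgesAmong-∈ˡ : ∀ vs {e} → e ∈ edgesAmong vs → proj₁ e ∈ vs
    edgesAmong-∈ˡ (v ∷ vs) e∈ with ∈-++⁻ (map (v ,_) (filter (adj? v) vs)) e∈
    ... | inj₂ e∈′ = there (edgesAmong-∈ˡ vs e∈′)
    ... | inj₁ e∈′ with ∈-map⁻ (v ,_) e∈′
    ...   | _ , _ , refl = here refl

    edgesAmong-unique : ∀ {vs} → Unique vs → Unique (edgesAmong vs)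
    edgesAmong-unique []                       = []
    edgesAmong-unique {v ∷ vs} (v∉vs ∷ vs!) =
      Unique.++⁺ (Unique.map⁺ ,-injectiveʳ (Unique.filter⁺ (adj? v) vs!))
                 (edgesAmong-unique vs!) disjoint
      where
      disjoint : ∀ {e} → e ∈ map (v ,_) (filter (adj? v) vs) × e ∈ edgesAmong vs → ⊥
      disjoint (e∈₁ , e∈₂) with ∈-map⁻ (v ,_) e∈₁
      ... | _ , _ , refl = All.lookup v∉vs (edgesAmong-∈ˡ vs e∈₂) refl

  -- Every edge {u , v} occurs exactly once, as the pair (u , v) in which u
  -- precedes v in `vertices`.
  edges : List (V × V)
  edges = edgesAmong vertices

  ShareEndpoint : Rel (V × V) 0ℓ
  ShareEndpoint (a , b) (c , d) = (a ≡ c ⊎ a ≡ d) ⊎ (b ≡ c ⊎ b ≡ d)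

  private
    shareEndpoint? : Decidable ShareEndpoint
    shareEndpoint? (a , b) (c , d) =
      ((a ≟ c) ⊎-dec (a ≟ d)) ⊎-dec ((b ≟ c) ⊎-dec (b ≟ d))

    shareEndpoint-sym : Symmetric ShareEndpoint
    shareEndpoint-sym (inj₁ (inj₁ p)) = inj₁ (inj₁ (sym p))
    shareEndpoint-sym (inj₁ (inj₂ p)) = inj₂ (inj₁ (sym p))
    shareEndpoint-sym (inj₂ (inj₁ p)) = inj₁ (inj₂ (sym p))
    shareEndpoint-sym (inj₂ (inj₂ p)) = inj₂ (inj₂ (sym p))

  lineGraph : Graph
  lineGraph = record
    { V          = V × V
    ; _≟_        = _≟ᵉ_
    ; vertices   = edges
    ; unique     = edgesAmong-unique unique
    ; Adj        = λ e f → e ≢ f × ShareEndpoint e f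
    ; adj?       = λ e f → ¬? (e ≟ᵉ f) ×-dec shareEndpoint? e f
    ; Adj-sym    = λ (e≢f , s) → (λ f≡e → e≢f (sym f≡e)) , shareEndpoint-sym s
    ; Adj-irrefl = λ (e≢e , _) → e≢e refl
    }
    where
    _≟ᵉ_ : DecidableEquality (V × V)
    _≟ᵉ_ = ≡-dec _≟_ _≟_

_△_ : ∀ {n} → Subset n → Subset n → Subset n
p △ q = (p ─ q) ∪ (q ─ p)

subsets : ∀ n → List (Subset n)
subsets zero    = [] ∷ []
subsets (suc n) = map (outside ∷_) (subsets n) ++ map (inside ∷_) (subsets n)

∈-subsets : ∀ {n} (p : Subset n) → p ∈ subsets n
∈-subsets []            = here refl
∈-subsets (outside ∷ p) = ∈-++⁺ˡ (∈-map⁺ (outside ∷_) (∈-subsets p))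
∈-subsets (inside ∷ p)  = ∈-++⁺ʳ _ (∈-map⁺ (inside ∷_) (∈-subsets p))

private
  subsets-unique : ∀ n → Unique (subsets n)
  subsets-unique zero    = All.[] ∷ []
  subsets-unique (suc n) =
    Unique.++⁺ (Unique.map⁺ Vec.∷-injectiveʳ (subsets-unique n))
               (Unique.map⁺ Vec.∷-injectiveʳ (subsets-unique n)) disjoint
    where
    disjoint : ∀ {p} → p ∈ map (outside ∷_) (subsets n) × p ∈ map (inside ∷_) (subsets n) → ⊥
    disjoint (p∈₁ , p∈₂) with ∈-map⁻ (outside ∷_) p∈₁
    ... | _ , _ , refl with ∈-map⁻ (inside ∷_) p∈₂
    ...   | _ , _ , ()

  △-comm : ∀ {n} (p q : Subset n) → p △ q ≡ q △ p
  △-comm p q = Vec.zipWith-comm Bool.∨-comm (p ─ q) (q ─ p)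

  ∣p△p∣≡0 : ∀ {n} (p : Subset n) → ∣ p △ p ∣ ≡ 0
  ∣p△p∣≡0 []            = refl
  ∣p△p∣≡0 (outside ∷ p) = ∣p△p∣≡0 p
  ∣p△p∣≡0 (inside ∷ p)  = ∣p△p∣≡0 p

BL : ℕ → Graph
BL n = record
  { V          = Subset n
  ; _≟_        = Vec.≡-dec Bool._≟_
  ; vertices   = subsets n
  ; unique     = subsets-unique n
  ; Adj        = λ p q → ∣ p △ q ∣ ≡ 1
  ; adj?       = λ p q → ∣ p △ q ∣ ℕ.≟ 1
  ; Adj-sym    = λ {p} {q} → trans (cong ∣_∣ (△-comm q p))
  ; Adj-irrefl = λ {p} e → ℕ.0≢1+n (trans (sym (∣p△p∣≡0 p)) e)
  }

-- BLₙ(k-1, k); the condition ∣ p ∣ = k - 1 is written without subtraction.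
BLlayers : ℕ → ℕ → Graph
BLlayers n k = induced (BL n) {λ p → suc ∣ p ∣ ≡ k ⊎ ∣ p ∣ ≡ k}
                 (λ p → (suc ∣ p ∣ ℕ.≟ k) ⊎-dec (∣ p ∣ ℕ.≟ k))

-- ℤ[X].  The polynomial a₀ + a₁ X + ⋯ is the list a₀ ∷ a₁ ∷ ⋯, trailing
-- zeros being allowed, so that equality is equality of all coefficients.

Poly : Set
Poly = List ℤ

coeff : Poly → ℕ → ℤ
coeff []      _       = 0ℤ
coeff (a ∷ p) zero    = a
coeff (a ∷ p) (suc i) = coeff p i

infixl 6 _+ₚ_
infixl 7 _*ₚ_
infix  4 _≈ₚ_

_≈ₚ_ : Rel Poly 0ℓ
p ≈ₚ q = ∀ i → coeff p i ≡ coeff q i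

_+ₚ_ : Poly → Poly → Poly
[]      +ₚ q       = q
(a ∷ p) +ₚ []      = a ∷ p
(a ∷ p) +ₚ (b ∷ q) = (a ℤ.+ b) ∷ (p +ₚ q)

_*ₚ_ : Poly → Poly → Poly
[]      *ₚ q = []
(a ∷ p) *ₚ q = map (a ℤ.*_) q +ₚ (0ℤ ∷ (p *ₚ q))

-ₚ_ : Poly → Poly
-ₚ p = map (λ a → ℤ.- a) p

const : ℤ → Poly
const a = a ∷ []

X : Poly
X = 0ℤ ∷ 1ℤ ∷ []

ℤ[X] : RawRing 0ℓ 0ℓ
ℤ[X] = record
  { Carrier = Poly
  ; _≈_     = _≈ₚ_
  ; _+_     = _+ₚ_
  ; _*_     = _*ₚ_
  ; -_      = -ₚ_
  ; 0#      = []
  ; 1#      = const 1ℤ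
  }

Matrix : ∀ {a} → Set a → ℕ → Set a
Matrix A n = Fin n → Fin n → A

-- Laplace expansion along the first row.
module _ {c ℓ} (R : RawRing c ℓ) where
  open RawRing R
  open RawSemiringDefinitions rawSemiring using (sum; _^_)

  det : ∀ {n} → Matrix Carrier n → Carrier
  det {zero}  M = 1#
  det {suc n} M = sum λ j →
    ((- 1#) ^ toℕ j) * (M zero j * det (λ i → removeAt (M (suc i)) j))

-- det (X I - M)
charPoly : ∀ {n} → Matrix ℤ n → Poly
charPoly M = det ℤ[X] λ i j →
  (if does (i Fin.≟ j) then X else []) +ₚ (-ₚ const (M i j))

adjacencyMatrix : (Γ : Graph) → Matrix ℤ (Graph.order Γ)
adjacencyMatrix Γ i j =
  if does (adj? (lookup vertices i) (lookup vertices j)) then 1ℤ else 0ℤ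
  where open Graph Γ

-- The monic polynomial ∏ (X - λ) with the given multiset of roots.
fromRoots : List ℤ → Poly
fromRoots = foldr (λ r p → (X +ₚ (-ₚ const r)) *ₚ p) (const 1ℤ)

-- The eigenvalues of the adjacency matrix, with multiplicity, are exactly the
-- entries of the list (whose order is immaterial): its characteristic
-- polynomial splits as ∏ (X - λ).  Such a splitting over ℤ leaves no further
-- eigenvalue in ℝ or ℂ, and algebraic and geometric multiplicities agree
-- because the matrix is symmetric.
HasSpectrum : Graph → List ℤ → Set
HasSpectrum Γ eigenvalues = charPoly (adjacencyMatrix Γ) ≈ₚ fromRoots eigenvalues

-- Binomial coefficients with an integer lower index, zero when it is negative.
binom : ℕ → ℤ → ℕ
binom n (+ i)    = n C i
binom n -[1+ _ ] = 0

{-# OPTIONS --safe #-}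

-- Since a polynomial is determined by its values at large integers, everything
-- happens in ℤ, for a fixed large x.  The engine is Sylvester's identity
--     tᵇ det (t I - A B) = tᵃ det (t I - B A)
-- for an a × b matrix A and a b × a matrix B.  With the edge-vertex incidence
-- matrix as A it turns the line graph into
--     det [ y I , - M ; - Mᵀ , y I ] = det (y² I - M Mᵀ),   y = x + 2 - k,
-- where M is the inclusion matrix between the layers k - 1 and k.  On layer j
-- the up and down operators satisfy D U = U D + (n - 2j) I, so that Sylvester's
-- identity also gives
--     det (s I - D U | layer j) = rᵉ det (r I - D U | layer j - 1),
--     r = s - (n - 2j),   e = C(n, j) - C(n, j - 1).
-- Iterating this down from s = y² and layer k - 1 produces the factors
-- y² - (k - i)² with the required multiplicities.

module Submission where

open import Defs
open import Algebra.Bundles.Raw using (RawRing)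
import Algebra.Definitions.RawSemiring as RawSemiringDefinitions
open import Data.Bool.Base using (true; false; if_then_else_)
import Data.Bool.Properties as Bool
open import Data.Fin.Base using (Fin; zero; suc; toℕ; punchIn; punchOut; lift; splitAt; _↑ˡ_; _↑ʳ_)
import Data.Fin.Properties as Fin
open import Data.Fin.Subset using (Subset; inside; outside)
import Data.Integer.Properties as ℤ
open import Data.Integer.Tactic.RingSolver using (solve-∀)
open import Data.List.Base as List using (List; []; _∷_; filter; length; lookup)
open import Data.List.Membership.Propositional using (_∈_)
open import Data.List.Membership.Propositional.Properties using (∈-lookup; ∈-filter⁺; ∈-filter⁻; ∈-map⁻; ∈-++⁻)
import Data.List.Properties as List
open import Data.List.Relation.Unary.All as All using (All; []; _∷_)
import Data.List.Relation.Unary.All.Properties as All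
open import Data.List.Relation.Unary.AllPairs as AllPairs using (AllPairs; []; _∷_)
import Data.List.Relation.Unary.AllPairs.Properties as AllPairs
open import Data.List.Relation.Unary.Any using (here; there)
open import Data.List.Relation.Unary.Unique.Propositional using (Unique)
import Data.List.Relation.Unary.Unique.Propositional.Properties as Unique
open import Data.Nat.Base as ℕ using (ℕ; zero; suc)
open import Data.Nat.Combinatorics as Comb using (nCk+nC[k+1]≡[n+1]C[k+1]; nCn≡1; nCk≡nC[n∸k])
import Data.Nat.Properties as ℕ
open import Data.Product.Base using (_×_; _,_; proj₁; proj₂)
open import Data.Sum.Base as Sum using (_⊎_; inj₁; inj₂; [_,_]′)
open import Data.Sum.Properties using ([,]-map; map-map)
import Data.Vec.Base as Vec
import Data.Vec.Functional as Vector
import Data.Vec.Functional.Properties as Vector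
import Data.Vec.Properties as Vec
open import Function.Base using (_∘_; id)
open import Level using (0ℓ)
open import Relation.Binary.Definitions using (DecidableEquality)
open import Relation.Binary.PropositionalEquality
open import Relation.Nullary.Decidable using (Dec; does; yes; no; _⊎-dec_)
open import Relation.Nullary.Negation using (¬_; contradiction)
open import Relation.Unary using (Pred; Decidable)
open import Algebra.Properties.Semiring.Sum ℤ.+-*-semiring

-- No step divides: powers of t = x + 2, of y and of r stay as factors on both sides, and they are
-- cancelled only once x is so large that these numbers are non-zero. The condition n = 2k - 1 does
-- three things. Both layers get the same size, so the powers of y coming from the Schur complement
-- cancel exactly. Both get degree k, so the Gram matrix of the incidence columns is k I plus the
-- adjacency matrix, and the single shift y = t - k serves both diagonal blocks. On layer j = k - 1
-- - d the commutator n - 2j = 2d + 1 is a difference of consecutive squares, which is why the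
-- recursion runs through y² - d². The eigenvalue -2 has two sources. With C = C(n, k - 1), the k C
-- edges outnumber the 2 C vertices by (k - 2) C; and the index i = 0, which carries the pair of
-- roots -2 and 2k - 2, contributes one more. As `det` is a Laplace expansion along the first row,
-- linearity and alternation in the rows have to be derived from that expansion.

module Determinant where

  -- Determinants as alternating multilinear functions of their rows.

  open import Data.Integer.Base using (ℤ; 0ℤ; 1ℤ; _+_; _*_; _-_; -_; _^_; +-*-rawRing)

  private variable
    a b m n o : ℕ

  open RawSemiringDefinitions (RawRing.rawSemiring +-*-rawRing) using () renaming (_^_ to _^ˢ_) public

  infixl 6 _[_]≔_

  _[_]≔_ : {A : Set} → (Fin n → A) → Fin n → A → Fin n → A
  r [ i ]≔ x = Vector.updateAt r i (λ _ → x)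

  -- `_^ˢ_` is the generic power that `det` uses for its signs; all other powers are those of ℤ.
  sgn : Fin n → ℤ
  sgn j = (- 1ℤ) ^ˢ toℕ j

  detℤ : Matrix ℤ n → ℤ
  detℤ = det +-*-rawRing

  minor : Matrix ℤ (suc n) → Fin (suc n) → Matrix ℤ n
  minor M j i = Vector.removeAt (M (suc i)) j

  sum-linear : ∀ c {f g h : Fin n → ℤ} → (∀ j → f j ≡ c * g j + h j) → sum f ≡ c * sum g + sum h
  sum-linear c {f} {g} {h} eq = begin
    sum f                               ≡⟨ sum-cong-≗ eq ⟩
    sum (λ j → c * g j + h j)           ≡⟨ ∑-distrib-+ (λ j → c * g j) h ⟩
    sum (λ j → c * g j) + sum h         ≡⟨ cong (_+ sum h) (*-distribˡ-sum c g) ⟨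
    c * sum g + sum h                   ∎
    where open ≡-Reasoning

  sum-zero : {f : Fin n → ℤ} → (∀ j → f j ≡ 0ℤ) → sum f ≡ 0ℤ
  sum-zero {n} eq = trans (sum-cong-≗ eq) (sum-replicate-zero n)

  sum-++ : (f : Fin (a ℕ.+ b) → ℤ) → sum f ≡ sum (λ i → f (i ↑ˡ b)) + sum (λ i → f (a ↑ʳ i))
  sum-++ {zero}  f = sym (ℤ.+-identityˡ _)
  sum-++ {suc a} f = trans (cong (f zero +_) (sum-++ {a} (f ∘ suc))) (sym (ℤ.+-assoc (f zero) _ _))

  -- The functional takes m rows of any length n, since later only one block of rows of a square
  -- matrix varies while the other block is frozen. `linear` compares three families that agree away
  -- from row i, so callers are free in how they present the rows; `resp-≗` stands in for function
  -- extensionality.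
  record Multilinear (F : (Fin m → Fin n → ℤ) → ℤ) : Set where
    field
      resp-≗ : ∀ {r s} → (∀ i → r i ≗ s i) → F r ≡ F s
      linear : ∀ i c {r s u} → (∀ k → k ≢ i → r k ≗ s k) → (∀ k → k ≢ i → r k ≗ u k) →
               (∀ x → r i x ≡ c * s i x + u i x) → F r ≡ c * F s + F u

  open Multilinear

  det-multilinear : ∀ {n} → Multilinear (detℤ {n})
  det-multilinear {zero} .resp-≗ _ = refl
  det-multilinear {zero} .linear ()
  det-multilinear {suc n} .resp-≗ r≗s = sum-cong-≗ λ j →
    cong (sgn j *_) (cong₂ _*_ (r≗s zero j)
      (det-multilinear .resp-≗ λ i x → r≗s (suc i) (punchIn j x)))
  det-multilinear {suc n} .linear zero c {r} {s} {u} r≗s r≗u eq = sum-linear c λ j → begin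
    sgn j * (r zero j * detℤ (minor r j))
      ≡⟨ cong (λ z → sgn j * (z * detℤ (minor r j))) (eq j) ⟩
    sgn j * ((c * s zero j + u zero j) * detℤ (minor r j))
      ≡⟨ expand (sgn j) c (s zero j) (u zero j) (detℤ (minor r j)) ⟩
    c * (sgn j * (s zero j * detℤ (minor r j))) + sgn j * (u zero j * detℤ (minor r j))
      ≡⟨ cong₂ (λ d e → c * (sgn j * (s zero j * d)) + sgn j * (u zero j * e))
           (det-multilinear .resp-≗ λ i x → r≗s (suc i) (λ ()) (punchIn j x))
           (det-multilinear .resp-≗ λ i x → r≗u (suc i) (λ ()) (punchIn j x)) ⟩
    c * (sgn j * (s zero j * detℤ (minor s j))) + sgn j * (u zero j * detℤ (minor u j)) ∎
    where
    open ≡-Reasoning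
    expand : ∀ e c s u d → e * ((c * s + u) * d) ≡ c * (e * (s * d)) + e * (u * d)
    expand = solve-∀
  det-multilinear {suc n} .linear (suc i) c {r} {s} {u} r≗s r≗u eq = sum-linear c λ j → begin
    sgn j * (r zero j * detℤ (minor r j))
      ≡⟨ cong (λ z → sgn j * (r zero j * z)) (det-multilinear .linear i c
           (λ k k≢i x → r≗s (suc k) (k≢i ∘ Fin.suc-injective) (punchIn j x))
           (λ k k≢i x → r≗u (suc k) (k≢i ∘ Fin.suc-injective) (punchIn j x))
           (λ x → eq (punchIn j x))) ⟩
    sgn j * (r zero j * (c * detℤ (minor s j) + detℤ (minor u j)))
      ≡⟨ expand (sgn j) c (r zero j) (detℤ (minor s j)) (detℤ (minor u j)) ⟩
    c * (sgn j * (r zero j * detℤ (minor s j))) + sgn j * (r zero j * detℤ (minor u j))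
      ≡⟨ cong₂ (λ y z → c * (sgn j * (y * detℤ (minor s j))) + sgn j * (z * detℤ (minor u j)))
           (r≗s zero (λ ()) j) (r≗u zero (λ ()) j) ⟩
    c * (sgn j * (s zero j * detℤ (minor s j))) + sgn j * (u zero j * detℤ (minor u j)) ∎
    where
    open ≡-Reasoning
    expand : ∀ e c r s u → e * (r * (c * s + u)) ≡ c * (e * (r * s)) + e * (r * u)
    expand = solve-∀

  det-cong : {M N : Matrix ℤ n} → (∀ i j → M i j ≡ N i j) → detℤ M ≡ detℤ N
  det-cong = det-multilinear .resp-≗

  module _ {F : (Fin m → Fin n → ℤ) → ℤ} (F-lin : Multilinear F) where

    -- A zero row is -1 times itself plus itself, so F r = - F r + F r.
    zero-row : ∀ i {r} → (∀ x → r i x ≡ 0ℤ) → F r ≡ 0ℤ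
    zero-row i {r} eq = trans (F-lin .linear i (- 1ℤ) {s = r} {u = r} (λ _ _ _ → refl) (λ _ _ _ → refl)
      λ x → trans (eq x) (sym (cancel (r i x)))) (cancel (F r))
      where
      cancel : ∀ z → - 1ℤ * z + z ≡ 0ℤ
      cancel = solve-∀

    -- Polarization: F vanishes on the rows u + v, u + v in places i and j.
    swap-rows : ∀ {i j} → i ≢ j → (∀ r → r i ≗ r j → F r ≡ 0ℤ) →
                ∀ r → F ((r [ j ]≔ r i) [ i ]≔ r j) ≡ - F r
    swap-rows {i} {j} i≢j alt r = sym (neg-unique (begin
      0ℤ                                                          ≡⟨ vanish (u⊕v) ⟨
      F (T u⊕v u⊕v)                                               ≡⟨ addᵢ u v u⊕v ⟩
      1ℤ * F (T u u⊕v) + F (T v u⊕v)                              ≡⟨ cong₂ (λ y z → 1ℤ * y + z) (addⱼ u u v) (addⱼ v u v) ⟩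
      1ℤ * (1ℤ * F (T u u) + F (T u v)) + (1ℤ * F (T v u) + F (T v v))
        ≡⟨ cong₂ (λ y z → 1ℤ * (1ℤ * y + F (T u v)) + (1ℤ * F (T v u) + z)) (vanish u) (vanish v) ⟩
      1ℤ * (1ℤ * 0ℤ + F (T u v)) + (1ℤ * F (T v u) + 0ℤ)          ≡⟨ tidy (F (T u v)) (F (T v u)) ⟩
      F (T u v) + F (T v u)                                       ≡⟨ cong (_+ F (T v u)) (F-lin .resp-≗ restore) ⟩
      F r + F (T v u)                                             ∎))
      where
      open ≡-Reasoning
      tidy : ∀ y z → 1ℤ * (1ℤ * 0ℤ + y) + (1ℤ * z + 0ℤ) ≡ y + z
      tidy = solve-∀
      neg-unique : ∀ {y z} → 0ℤ ≡ y + z → - y ≡ z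
      neg-unique {y} {z} eq = trans (sym (ℤ.+-identityʳ (- y))) (trans (cong (- y +_) eq) (canc y z))
        where
        canc : ∀ y z → - y + (y + z) ≡ z
        canc = solve-∀
      u v u⊕v : Fin n → ℤ
      u = r i
      v = r j
      u⊕v x = u x + v x
      T : (Fin n → ℤ) → (Fin n → ℤ) → Fin m → Fin n → ℤ
      T y z = (r [ j ]≔ z) [ i ]≔ y
      at-i : ∀ y z → T y z i ≡ y
      at-i y z = Vector.updateAt-updates i (r [ j ]≔ z)
      at-j : ∀ y z → T y z j ≡ z
      at-j y z = trans (Vector.updateAt-minimal j i (r [ j ]≔ z) (i≢j ∘ sym)) (Vector.updateAt-updates j r)
      off-i : ∀ y y′ z k → k ≢ i → T y z k ≗ T y′ z k
      off-i y y′ z k k≢i x = cong-app (trans (Vector.updateAt-minimal k i (r [ j ]≔ z) k≢i)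
        (sym (Vector.updateAt-minimal k i (r [ j ]≔ z) k≢i))) x
      off-j : ∀ y z z′ k → k ≢ j → T y z k ≗ T y z′ k
      off-j y z z′ k k≢j x with k Fin.≟ i
      ... | yes refl = cong-app (trans (at-i y z) (sym (at-i y z′))) x
      ... | no k≢i = cong-app (trans
        (trans (Vector.updateAt-minimal k i (r [ j ]≔ z) k≢i) (Vector.updateAt-minimal k j r k≢j))
        (sym (trans (Vector.updateAt-minimal k i (r [ j ]≔ z′) k≢i) (Vector.updateAt-minimal k j r k≢j)))) x
      vanish : ∀ y → F (T y y) ≡ 0ℤ
      vanish y = alt (T y y) (cong-app (trans (at-i y y) (sym (at-j y y))))
      addᵢ : ∀ y y′ z → F (T (λ x → y x + y′ x) z) ≡ 1ℤ * F (T y z) + F (T y′ z)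
      addᵢ y y′ z = F-lin .linear i 1ℤ (off-i _ _ z) (off-i _ _ z) λ x →
        trans (cong-app (at-i _ z) x) (trans (cong (_+ y′ x) (sym (ℤ.*-identityˡ (y x))))
          (sym (cong₂ (λ p q → 1ℤ * p x + q x) (at-i y z) (at-i y′ z))))
      addⱼ : ∀ y z z′ → F (T y (λ x → z x + z′ x)) ≡ 1ℤ * F (T y z) + F (T y z′)
      addⱼ y z z′ = F-lin .linear j 1ℤ (off-j y _ _) (off-j y _ _) λ x →
        trans (cong-app (at-j y _) x) (trans (cong (_+ z′ x) (sym (ℤ.*-identityˡ (z x))))
          (sym (cong₂ (λ p q → 1ℤ * p x + q x) (at-j y z) (at-j y z′))))
      restore : ∀ k → T u v k ≗ r k
      restore k x with k Fin.≟ i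
      ... | yes refl = cong-app (at-i u v) x
      ... | no k≢i with k Fin.≟ j
      ...   | yes refl = cong-app (at-j u v) x
      ...   | no k≢j = cong-app (trans (Vector.updateAt-minimal k i (r [ j ]≔ v) k≢i) (Vector.updateAt-minimal k j r k≢j)) x

  -- The terms (0, l) cancel against the terms (l + 1, 0).
  double-expansion : ∀ {n} (r : Fin (suc (suc n)) → ℤ) (g : (Fin n → Fin (suc (suc n))) → ℤ) →
    (∀ {f f′} → f ≗ f′ → g f ≡ g f′) →
    sum (λ j → sgn j * (r j * sum (λ l → sgn l * (r (punchIn j l) * g (punchIn j ∘ punchIn l))))) ≡ 0ℤ
  double-expansion {n} r g g-cong = begin
    1ℤ * (r zero * S₀) + sum (λ j → (- 1ℤ * sgn j) * (r (suc j) * (1ℤ * (r zero * g (punchIn (suc j) ∘ suc)) + R j)))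
      ≡⟨ cong (1ℤ * (r zero * S₀) +_) (sum-linear (- r zero) λ j → trans
           (cong (λ z → (- 1ℤ * sgn j) * (r (suc j) * (1ℤ * (r zero * z) + R j))) (g-cong (λ x → refl)))
           (term (sgn j) (r (suc j)) (r zero) (g (suc ∘ punchIn j)) (R j))) ⟩
    1ℤ * (r zero * S₀) + (- r zero * S₀ + sum (λ j → - (sgn j * (r (suc j) * R j))))
      ≡⟨ cong (λ z → 1ℤ * (r zero * S₀) + (- r zero * S₀ + z)) (rest r g g-cong) ⟩
    1ℤ * (r zero * S₀) + (- r zero * S₀ + 0ℤ)
      ≡⟨ cancel (r zero) S₀ ⟩
    0ℤ ∎
    where
    open ≡-Reasoning
    S₀ : ℤ
    S₀ = sum (λ l → sgn l * (r (suc l) * g (suc ∘ punchIn l)))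
    R : Fin (suc n) → ℤ
    R j = sum (λ l → (- 1ℤ * sgn l) * (r (suc (punchIn j l)) * g (punchIn (suc j) ∘ punchIn (suc l))))
    term : ∀ e s r g R → (- 1ℤ * e) * (s * (1ℤ * (r * g) + R)) ≡ - r * (e * (s * g)) + - (e * (s * R))
    term = solve-∀
    cancel : ∀ r s → 1ℤ * (r * s) + (- r * s + 0ℤ) ≡ 0ℤ
    cancel = solve-∀
    -- The terms (j + 1, l + 1) form the same double sum one size smaller, for `r ∘ suc` and
    -- `g ∘ lift 1`: `lift 1` keeps index 0 in front, and the two extra minus signs cancel.
    rest : ∀ {n} (r : Fin (suc (suc n)) → ℤ) (g : (Fin n → Fin (suc (suc n))) → ℤ) →
      (∀ {f f′} → f ≗ f′ → g f ≡ g f′) →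
      sum (λ j → - (sgn j * (r (suc j) * sum (λ l → (- 1ℤ * sgn l) * (r (suc (punchIn j l)) * g (punchIn (suc j) ∘ punchIn (suc l))))))) ≡ 0ℤ
    rest {zero}  r g g-cong = sum-zero λ j → zeros (sgn j) (r (suc j))
      where
      zeros : ∀ x y → - (x * (y * 0ℤ)) ≡ 0ℤ
      zeros = solve-∀
    rest {suc n} r g g-cong = trans (sum-cong-≗ λ j → trans
        (cong (λ z → - (sgn j * (r (suc j) * z))) (trans (sum-cong-≗ (inner j)) (sym (*-distribˡ-sum (- 1ℤ) (G j)))))
        (signs (sgn j) (r (suc j)) (sum (G j))))
      (double-expansion (r ∘ suc) (g ∘ lift 1) λ eq → g-cong λ { zero → refl ; (suc x) → cong suc (eq x) })
      where
      G : Fin (suc (suc n)) → Fin (suc n) → ℤ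
      G j l = sgn l * (r (suc (punchIn j l)) * g (lift 1 (punchIn j ∘ punchIn l)))
      inner : ∀ j l → (- 1ℤ * sgn l) * (r (suc (punchIn j l)) * g (punchIn (suc j) ∘ punchIn (suc l))) ≡ - 1ℤ * G j l
      inner j l = trans (ℤ.*-assoc (- 1ℤ) (sgn l) (r (suc (punchIn j l)) * g (punchIn (suc j) ∘ punchIn (suc l))))
        (cong (λ z → - 1ℤ * (sgn l * (r (suc (punchIn j l)) * z))) (g-cong λ { zero → refl ; (suc x) → refl }))
      signs : ∀ x y z → - (x * (y * (- 1ℤ * z))) ≡ x * (y * z)
      signs = solve-∀

  private
    alternating-tail : (∀ {i j : Fin n} → i ≢ j → (M : Matrix ℤ n) → M i ≗ M j → detℤ M ≡ 0ℤ) →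
      ∀ {i j : Fin n} → i ≢ j → (M : Matrix ℤ (suc n)) → M (suc i) ≗ M (suc j) → detℤ M ≡ 0ℤ
    alternating-tail alt i≢j M eq = sum-zero λ j → trans
      (cong (λ z → sgn j * (M zero j * z)) (alt i≢j (minor M j) (λ x → eq (punchIn j x))))
      (zeros (sgn j) (M zero j))
      where
      zeros : ∀ x y → x * (y * 0ℤ) ≡ 0ℤ
      zeros = solve-∀

    -- Expanding along both equal rows gives the sum of `double-expansion`, where g is the minor of
    -- the remaining rows in the columns that are left.
    alternating₀₁ : (M : Matrix ℤ (suc (suc n))) → M zero ≗ M (suc zero) → detℤ M ≡ 0ℤ
    alternating₀₁ M eq = trans
      (sum-cong-≗ λ j → cong (λ z → sgn j * (M zero j * z)) (sum-cong-≗ λ l →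
        cong (λ z → sgn l * (z * detℤ (minor (minor M j) l))) (sym (eq (punchIn j l)))))
      (double-expansion (M zero) (λ f → detℤ λ i x → M (suc (suc i)) (f x))
        λ f≗f′ → det-cong λ i x → cong (M (suc (suc i))) (f≗f′ x))

  det-alternating : ∀ {n} {i j : Fin n} → i ≢ j → (M : Matrix ℤ n) → M i ≗ M j → detℤ M ≡ 0ℤ
  det-alternating₀ : ∀ {n} (j : Fin n) (M : Matrix ℤ (suc n)) → M zero ≗ M (suc j) → detℤ M ≡ 0ℤ

  det-alternating {i = zero}  {zero}  i≢j M eq = contradiction refl i≢j
  det-alternating {i = zero}  {suc j} i≢j M eq = det-alternating₀ j M eq
  det-alternating {i = suc i} {zero}  i≢j M eq = det-alternating₀ i M (sym ∘ eq)
  det-alternating {i = suc i} {suc j} i≢j M eq = alternating-tail det-alternating (i≢j ∘ cong suc) M eq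

  det-alternating₀ zero    M eq = alternating₀₁ M eq
  -- Exchanging rows 1 and j + 2 moves the copy of row 0 next to it. The exchange only needs
  -- alternation among the tail rows, which is the induction hypothesis on the size.
  det-alternating₀ (suc j) M eq = ℤ.neg-injective (trans
    (sym (swap-rows det-multilinear {suc zero} {suc (suc j)} (λ ())
      (alternating-tail det-alternating λ ()) M))
    (alternating₀₁ (M [ suc (suc j) ]≔ M (suc zero) [ suc zero ]≔ M (suc (suc j))) eq))

  module _ {F : (Fin m → Fin n → ℤ) → ℤ} (F-lin : Multilinear F) {w : Fin o → Fin n → ℤ}
           (vanish : ∀ i l {r} → r i ≗ w l → F r ≡ 0ℤ) where
    private
      combination : ∀ {q} i (h : Fin q → Fin o) (c : Fin q → ℤ) {r} →
        (∀ x → r i x ≡ sum (λ l → c l * w (h l) x)) → F r ≡ 0ℤ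
      combination {zero}  i h c eq = zero-row F-lin i eq
      combination {suc q} i h c {r} eq = begin
        F r                                   ≡⟨ F-lin .linear i (c zero) (off _) (off _) (λ x → trans (eq x)
                                                   (sym (cong₂ (λ y z → c zero * y x + z x) (at _) (at _)))) ⟩
        c zero * F (r [ i ]≔ w (h zero)) + F (r [ i ]≔ u)
          ≡⟨ cong₂ (λ y z → c zero * y + z) (vanish i (h zero) (cong-app (at _)))
               (combination i (h ∘ suc) (c ∘ suc) (cong-app (at _))) ⟩
        c zero * 0ℤ + 0ℤ                      ≡⟨ zeros (c zero) ⟩
        0ℤ                                    ∎
        where
        open ≡-Reasoning
        u : Fin n → ℤ
        u x = sum (λ l → c (suc l) * w (h (suc l)) x)
        at : ∀ y → (r [ i ]≔ y) i ≡ y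
        at y = Vector.updateAt-updates i r
        off : ∀ y k → k ≢ i → r k ≗ (r [ i ]≔ y) k
        off y k k≢i x = sym (cong-app (Vector.updateAt-minimal k i r k≢i) x)
        zeros : ∀ x → x * 0ℤ + 0ℤ ≡ 0ℤ
        zeros = solve-∀

    add-combination : ∀ i t (c : Fin o → ℤ) {r s} → (∀ k → k ≢ i → r k ≗ s k) →
      (∀ x → r i x ≡ t * s i x + sum (λ l → c l * w l x)) → F r ≡ t * F s
    add-combination i t c {r} {s} r≗s eq = begin
      F r                         ≡⟨ F-lin .linear i t r≗s (λ k k≢i x → sym (cong-app (Vector.updateAt-minimal k i r k≢i) x))
                                       (λ x → trans (eq x) (cong (λ y → t * s i x + y x) (sym at))) ⟩
      t * F s + F (r [ i ]≔ u)    ≡⟨ cong (t * F s +_) (combination i id c (cong-app at)) ⟩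
      t * F s + 0ℤ                ≡⟨ ℤ.+-identityʳ _ ⟩
      t * F s                     ∎
      where
      open ≡-Reasoning
      u : Fin n → ℤ
      u x = sum (λ l → c l * w l x)
      at : (r [ i ]≔ u) i ≡ u
      at = Vector.updateAt-updates i r

  -- The rows w are frozen inside F, so `vanish` is the alternating property between a varying row
  -- and a frozen one. The factor t stands for the division that ordinary elimination would need. In
  -- the induction each treated row is frozen in turn.
  row-operations : ∀ {F : (Fin m → Fin n → ℤ) → ℤ} → Multilinear F → {w : Fin o → Fin n → ℤ} →
    (∀ i l {r} → r i ≗ w l → F r ≡ 0ℤ) → ∀ t (c : Fin m → Fin o → ℤ) r →
    F (λ i x → t * r i x + sum (λ l → c i l * w l x)) ≡ t ^ m * F r
  row-operations {m = zero} {F = F} F-lin vanish t c r = trans (F-lin .resp-≗ λ ()) (sym (ℤ.*-identityˡ (F r)))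
  row-operations {m = suc m} {n} {F = F} F-lin {w} vanish t c r = begin
    F R                              ≡⟨ add-combination F-lin vanish zero t (c zero)
                                          (λ { zero k≢0 → contradiction refl k≢0 ; (suc k) _ _ → refl }) (λ _ → refl) ⟩
    t * F (r zero Vector.∷ Vector.tail R)          ≡⟨ cong (t *_) (row-operations {F = λ s → F (r zero Vector.∷ s)} F′-lin
                                          (λ i l → vanish (suc i) l) t (c ∘ suc) (r ∘ suc)) ⟩
    t * (t ^ m * F (r zero Vector.∷ Vector.tail r)) ≡⟨ ℤ.*-assoc t (t ^ m) _ ⟨
    t * t ^ m * F (r zero Vector.∷ Vector.tail r)  ≡⟨ cong (t * t ^ m *_) (F-lin .resp-≗ λ { zero _ → refl ; (suc _) _ → refl }) ⟩
    t * t ^ m * F r                  ∎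
    where
    open ≡-Reasoning
    R : Fin (suc m) → Fin n → ℤ
    R i x = t * r i x + sum (λ l → c i l * w l x)
    cons-agree : ∀ {i : Fin m} {s u : Fin m → Fin n → ℤ} → (∀ k → k ≢ i → s k ≗ u k) →
      ∀ k → k ≢ suc i → (r zero Vector.∷ s) k ≗ (r zero Vector.∷ u) k
    cons-agree s≗u zero    _   _ = refl
    cons-agree s≗u (suc k) k≢i   = s≗u k (k≢i ∘ cong suc)
    F′-lin : Multilinear (λ s → F (r zero Vector.∷ s))
    F′-lin .resp-≗ s≗u = F-lin .resp-≗ λ { zero _ → refl ; (suc i) → s≗u i }
    F′-lin .linear i c r≗s r≗u eq = F-lin .linear (suc i) c (cons-agree r≗s) (cons-agree r≗u) eq

  -- Block matrices.

  ↑ˡ≢↑ʳ : (i : Fin a) (l : Fin b) → i ↑ˡ b ≢ a ↑ʳ l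
  ↑ˡ≢↑ʳ {a} {b} i l eq with () ← trans (sym (Fin.splitAt-↑ˡ a i b)) (trans (cong (splitAt a) eq) (Fin.splitAt-↑ʳ a b l))

  ++-elim : ∀ {q} (P : Fin (a ℕ.+ b) → Set q) → (∀ i → P (i ↑ˡ b)) → (∀ l → P (a ↑ʳ l)) → ∀ x → P x
  ++-elim {a} {b} P left right x with splitAt a x in eq
  ... | inj₁ i = subst P (Fin.splitAt⁻¹-↑ˡ eq) (left i)
  ... | inj₂ l = subst P (Fin.splitAt⁻¹-↑ʳ eq) (right l)

  module _ {A : Set} (r : Fin a → A) (s : Fin b → A) where
    ++-↑ˡ : ∀ i → (r Vector.++ s) (i ↑ˡ b) ≡ r i
    ++-↑ˡ i = cong [ r , s ]′ (Fin.splitAt-↑ˡ a i b)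

    ++-↑ʳ : ∀ l → (r Vector.++ s) (a ↑ʳ l) ≡ s l
    ++-↑ʳ l = cong [ r , s ]′ (Fin.splitAt-↑ʳ a b l)

  module _ {F : (Fin (a ℕ.+ b) → Fin n → ℤ) → ℤ} (F-lin : Multilinear F) where
    private
      row-↑ˡ : ∀ (r : Fin a → Fin n → ℤ) (s : Fin b → Fin n → ℤ) i → (r Vector.++ s) (i ↑ˡ b) ≗ r i
      row-↑ˡ r s i = cong-app (++-↑ˡ r s i)
      row-↑ʳ : ∀ (r : Fin a → Fin n → ℤ) (s : Fin b → Fin n → ℤ) l → (r Vector.++ s) (a ↑ʳ l) ≗ s l
      row-↑ʳ r s l = cong-app (++-↑ʳ r s l)

    multilinear-++ˡ : ∀ w → Multilinear (λ r → F (r Vector.++ w))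
    multilinear-++ˡ w .resp-≗ {r} {s} r≗s = F-lin .resp-≗ (++-elim _
      (λ i x → trans (row-↑ˡ r w i x) (trans (r≗s i x) (sym (row-↑ˡ s w i x))))
      (λ l x → trans (row-↑ʳ r w l x) (sym (row-↑ʳ s w l x))))
    multilinear-++ˡ w .linear i c {r} {s} {u} r≗s r≗u eq = F-lin .linear (i ↑ˡ b) c (agree r≗s) (agree r≗u)
      λ x → trans (row-↑ˡ r w i x) (trans (eq x)
        (sym (cong₂ (λ y z → c * y + z) (row-↑ˡ s w i x) (row-↑ˡ u w i x))))
      where
      agree : ∀ {r s} → (∀ k → k ≢ i → r k ≗ s k) → ∀ k → k ≢ i ↑ˡ b → (r Vector.++ w) k ≗ (s Vector.++ w) k
      agree {r} {s} r≗s = ++-elim _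
        (λ k k≢i x → trans (row-↑ˡ r w k x) (trans (r≗s k (k≢i ∘ cong (_↑ˡ b)) x) (sym (row-↑ˡ s w k x))))
        (λ l _ x → trans (row-↑ʳ r w l x) (sym (row-↑ʳ s w l x)))

    multilinear-++ʳ : ∀ w → Multilinear (λ r → F (w Vector.++ r))
    multilinear-++ʳ w .resp-≗ {r} {s} r≗s = F-lin .resp-≗ (++-elim _
      (λ i x → trans (row-↑ˡ w r i x) (sym (row-↑ˡ w s i x)))
      (λ l x → trans (row-↑ʳ w r l x) (trans (r≗s l x) (sym (row-↑ʳ w s l x)))))
    multilinear-++ʳ w .linear i c {r} {s} {u} r≗s r≗u eq = F-lin .linear (a ↑ʳ i) c (agree r≗s) (agree r≗u)
      λ x → trans (row-↑ʳ w r i x) (trans (eq x)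
        (sym (cong₂ (λ y z → c * y + z) (row-↑ʳ w s i x) (row-↑ʳ w u i x))))
      where
      agree : ∀ {r s} → (∀ k → k ≢ i → r k ≗ s k) → ∀ k → k ≢ a ↑ʳ i → (w Vector.++ r) k ≗ (w Vector.++ s) k
      agree {r} {s} r≗s = ++-elim _
        (λ l _ x → trans (row-↑ˡ w r l x) (sym (row-↑ˡ w s l x)))
        (λ k k≢i x → trans (row-↑ʳ w r k x) (trans (r≗s k (k≢i ∘ cong (a ↑ʳ_)) x) (sym (row-↑ʳ w s k x))))

  -- The matrix t I, written with `does` as in `charPoly`. Since `does (suc i Fin.≟ suc j)` reduces
  -- to `does (i Fin.≟ j)`, deleting the first row and column yields the smaller `scalar t` by
  -- computation.
  scalar : ℤ → Matrix ℤ n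
  scalar t i j = if does (i Fin.≟ j) then t else 0ℤ

  Mat : ℕ → ℕ → Set
  Mat m n = Fin m → Fin n → ℤ

  beside : Mat m a → Mat m b → Mat m (a ℕ.+ b)
  beside P A i = P i Vector.++ A i

  block : Mat a a → Mat a b → Mat b a → Mat b b → Matrix ℤ (a ℕ.+ b)
  block P A B Q = beside P A Vector.++ beside B Q

  zeros : Mat m n
  zeros _ _ = 0ℤ

  det-scalar : ∀ n t → detℤ {n} (scalar t) ≡ t ^ n
  det-scalar zero    t = refl
  det-scalar (suc n) t = begin
    1ℤ * (t * detℤ {n} (scalar t)) + sum (λ j → sgn (suc j) * (0ℤ * detℤ (minor (scalar {suc n} t) (suc j))))
      ≡⟨ cong₂ _+_ (trans (ℤ.*-identityˡ _) (cong (t *_) (det-scalar n t)))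
           (sum-zero λ j → ℤ.*-zeroʳ (sgn {suc n} (suc j))) ⟩
    t * t ^ n + 0ℤ
      ≡⟨ ℤ.+-identityʳ _ ⟩
    t * t ^ n ∎
    where open ≡-Reasoning

  -- Row linearity says nothing about columns, so the expansion is used directly: the term l = j has
  -- a zero entry as a factor, and in every other minor the zero column survives at position
  -- `punchOut`.
  det-zero-column : ∀ {n} (j : Fin n) (M : Matrix ℤ n) → (∀ i → M i j ≡ 0ℤ) → detℤ M ≡ 0ℤ
  det-zero-column {suc n} j M eq = sum-zero λ l → term l (j Fin.≟ l)
    where
    zero₁ : ∀ x y → x * (0ℤ * y) ≡ 0ℤ
    zero₁ = solve-∀
    zero₂ : ∀ x y → x * (y * 0ℤ) ≡ 0ℤ
    zero₂ = solve-∀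
    term : ∀ l → Dec (j ≡ l) → sgn l * (M zero l * detℤ (minor M l)) ≡ 0ℤ
    term l (yes refl) = trans (cong (λ z → sgn j * (z * detℤ (minor M j))) (eq zero)) (zero₁ (sgn j) (detℤ (minor M j)))
    term l (no j≢l) = trans (cong (λ z → sgn l * (M zero l * z))
      (det-zero-column (punchOut (j≢l ∘ sym)) (minor M l)
        λ i → trans (cong (M (suc i)) (Fin.punchIn-punchOut (j≢l ∘ sym))) (eq (suc i))))
      (zero₂ (sgn l) (M zero l))

  det-block-upper : ∀ {a b} s (A : Mat a b) Q → detℤ (block (scalar s) A zeros Q) ≡ s ^ a * detℤ Q
  det-block-upper {zero}  s A Q = sym (ℤ.*-identityˡ _)
  det-block-upper {suc a} {b} s A Q = begin
    1ℤ * (s * detℤ (minor M zero)) + sum (λ j → sgn (suc j) * (M zero (suc j) * detℤ (minor M (suc j))))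
      ≡⟨ cong₂ _+_ (trans (ℤ.*-identityˡ _) (cong (s *_) (trans (det-cong minor₀) (det-block-upper s (A ∘ suc) Q))))
           (sum-zero λ j → trans (cong (λ z → sgn (suc j) * (M zero (suc j) * z)) (det-first-zero j))
             (zero₂ (sgn (suc j)) (M zero (suc j)))) ⟩
    s * (s ^ a * detℤ Q) + 0ℤ
      ≡⟨ trans (ℤ.+-identityʳ _) (sym (ℤ.*-assoc s (s ^ a) (detℤ Q))) ⟩
    s * s ^ a * detℤ Q ∎
    where
    open ≡-Reasoning
    zero₂ : ∀ x y → x * (y * 0ℤ) ≡ 0ℤ
    zero₂ = solve-∀
    M : Matrix ℤ (suc a ℕ.+ b)
    M = block (scalar s) A zeros Q
    minor₀ : ∀ i j → minor M zero i j ≡ block (scalar s) (A ∘ suc) zeros Q i j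
    minor₀ i j with splitAt a i
    ... | inj₁ _ = [,]-map (splitAt a j)
    ... | inj₂ _ = [,]-map (splitAt a j)
    first-column : ∀ i → M (suc i) zero ≡ 0ℤ
    first-column i with splitAt a i
    ... | inj₁ _ = refl
    ... | inj₂ _ = refl
    -- The entries of `A` in the first row may be non-zero, but their minors keep the first column,
    -- which is zero below the first row.
    det-first-zero : ∀ j → detℤ (minor M (suc j)) ≡ 0ℤ
    det-first-zero j = det-column (a ℕ.+ b) j (λ i → M (suc i)) first-column
      where
      -- Generalized to any size n so that `j` can force n to be a successor, which the form
      -- `a ℕ.+ b` hides.
      det-column : ∀ n (j : Fin n) (N : Fin n → Fin (suc n) → ℤ) → (∀ i → N i zero ≡ 0ℤ) →
                   detℤ (λ i → Vector.removeAt (N i) (suc j)) ≡ 0ℤ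
      det-column (suc n) j N eq = det-zero-column zero (λ i → Vector.removeAt (N i) (suc j)) eq

  splitAt-punchIn : ∀ {a b} (j : Fin (suc a)) (x : Fin (a ℕ.+ b)) →
                    splitAt (suc a) {b} (punchIn (j ↑ˡ b) x) ≡ Sum.map₁ (punchIn j) (splitAt a x)
  splitAt-punchIn {a}     zero    x    = refl
  splitAt-punchIn {suc a} (suc j) zero = refl
  splitAt-punchIn {suc a} {b} (suc j) (suc x) = begin
    Sum.map₁ suc (splitAt (suc a) (punchIn (j ↑ˡ b) x))      ≡⟨ cong (Sum.map₁ suc) (splitAt-punchIn j x) ⟩
    Sum.map₁ suc (Sum.map₁ (punchIn j) (splitAt a x))        ≡⟨ map-map (splitAt a x) ⟩
    Sum.map₁ (punchIn (suc j) ∘ suc) (splitAt a x)           ≡⟨ map-map (splitAt a x) ⟨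
    Sum.map₁ (punchIn (suc j)) (Sum.map₁ suc (splitAt a x))  ∎
    where open ≡-Reasoning

  -- The first row is zero outside `P`, and deleting it together with a column of `P` leaves a
  -- matrix of the same block shape.
  det-block-lower : ∀ {a b} P (B : Mat b a) t → detℤ (block P zeros B (scalar t)) ≡ t ^ b * detℤ P
  det-block-lower {zero}  {b} P B t = trans (det-scalar b t) (sym (ℤ.*-identityʳ _))
  det-block-lower {suc a} {b} P B t = begin
    sum (λ j → sgn j * (M zero j * detℤ (minor M j)))
      ≡⟨ sum-++ {suc a} (λ j → sgn j * (M zero j * detℤ (minor M j))) ⟩
    sum (λ j → sgn (j ↑ˡ b) * (M zero (j ↑ˡ b) * detℤ (minor M (j ↑ˡ b))))
      + sum (λ l → sgn (suc a ↑ʳ l) * (M zero (suc a ↑ʳ l) * detℤ (minor M (suc a ↑ʳ l))))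
      ≡⟨ cong₂ _+_ (sum-cong-≗ left) (sum-zero right) ⟩
    sum (λ j → t ^ b * (sgn j * (P zero j * detℤ (minor P j)))) + 0ℤ
      ≡⟨ ℤ.+-identityʳ _ ⟩
    sum (λ j → t ^ b * (sgn j * (P zero j * detℤ (minor P j))))
      ≡⟨ *-distribˡ-sum (t ^ b) (λ j → sgn j * (P zero j * detℤ (minor P j))) ⟨
    t ^ b * detℤ P ∎
    where
    open ≡-Reasoning
    M : Matrix ℤ (suc a ℕ.+ b)
    M = block P zeros B (scalar t)
    minor-M : ∀ j i x → minor M (j ↑ˡ b) i x ≡ block (minor P j) zeros (λ l → Vector.removeAt (B l) j) (scalar t) i x
    minor-M j i x with splitAt a i
    ... | inj₁ i′ = trans (cong [ P (suc i′) , zeros {suc a} {b} (suc i′) ]′ (splitAt-punchIn j x)) ([,]-map (splitAt a x))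
    ... | inj₂ l = trans (cong [ B l , scalar t l ]′ (splitAt-punchIn j x)) ([,]-map (splitAt a x))
    left : ∀ j → sgn (j ↑ˡ b) * (M zero (j ↑ˡ b) * detℤ (minor M (j ↑ˡ b)))
               ≡ t ^ b * (sgn j * (P zero j * detℤ (minor P j)))
    left j = begin
      sgn (j ↑ˡ b) * (M zero (j ↑ˡ b) * detℤ (minor M (j ↑ˡ b)))
        ≡⟨ cong₂ (λ e y → e * (y * detℤ (minor M (j ↑ˡ b)))) (cong ((- 1ℤ) ^ˢ_) (Fin.toℕ-↑ˡ j b)) (++-↑ˡ (P zero) (zeros {suc a} {b} zero) j) ⟩
      sgn j * (P zero j * detℤ (minor M (j ↑ˡ b)))
        ≡⟨ cong (λ z → sgn j * (P zero j * z))
             (trans (det-cong (minor-M j)) (det-block-lower (minor P j) (λ l → Vector.removeAt (B l) j) t)) ⟩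
      sgn j * (P zero j * (t ^ b * detℤ (minor P j)))
        ≡⟨ move (sgn j) (P zero j) (t ^ b) (detℤ (minor P j)) ⟩
      t ^ b * (sgn j * (P zero j * detℤ (minor P j))) ∎
      where
      move : ∀ e p t d → e * (p * (t * d)) ≡ t * (e * (p * d))
      move = solve-∀
    right : ∀ l → sgn (suc a ↑ʳ l) * (M zero (suc a ↑ʳ l) * detℤ (minor M (suc a ↑ʳ l))) ≡ 0ℤ
    right l = trans (cong (λ z → sgn (suc a ↑ʳ l) * (z * detℤ (minor M (suc a ↑ʳ l)))) (++-↑ʳ (P zero) (zeros {suc a} {b} zero) l))
      (zero₁ (sgn (suc a ↑ʳ l)) (detℤ (minor M (suc a ↑ʳ l))))
      where
      zero₁ : ∀ x y → x * (0ℤ * y) ≡ 0ℤ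
      zero₁ = solve-∀

  sum-scalar : ∀ {n} (f : Fin n → ℤ) t j → sum (λ l → f l * scalar t l j) ≡ f j * t
  sum-scalar {suc n} f t zero    = trans (cong (f zero * t +_) (sum-zero λ l → ℤ.*-zeroʳ (f (suc l)))) (ℤ.+-identityʳ _)
  sum-scalar {suc n} f t (suc j) = trans (cong₂ _+_ (ℤ.*-zeroʳ (f zero)) (sum-scalar (f ∘ suc) t j)) (ℤ.+-identityˡ _)

  *-scalar : ∀ s t (i j : Fin n) → s * scalar t i j ≡ scalar (s * t) i j
  *-scalar s t i j with does (i Fin.≟ j)
  ... | true  = refl
  ... | false = ℤ.*-zeroʳ s

  sum-neg : (f g : Fin n → ℤ) → sum (λ l → - f l * g l) ≡ - sum (λ l → f l * g l)
  sum-neg f g = begin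
    sum (λ l → - f l * g l)          ≡⟨ sum-cong-≗ (λ l → neg (f l) (g l)) ⟩
    sum (λ l → - 1ℤ * (f l * g l))   ≡⟨ *-distribˡ-sum (- 1ℤ) (λ l → f l * g l) ⟨
    - 1ℤ * sum (λ l → f l * g l)     ≡⟨ ℤ.-1*i≡-i (sum (λ l → f l * g l)) ⟩
    - sum (λ l → f l * g l)          ∎
    where
    open ≡-Reasoning
    neg : ∀ x y → - x * y ≡ - 1ℤ * (x * y)
    neg = solve-∀

  -- Schur complements and Sylvester's identity.

  module _ (s t : ℤ) (A : Mat a b) (B : Mat b a) where
    private
      K : Matrix ℤ (a ℕ.+ b)
      K = block (scalar s) A B (scalar t)
      top = beside (scalar s) A
      bottom = beside B (scalar t)

    -- Replacing the top rows by t top - A bottom costs t ^ a and clears the upper right block,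
    -- because t A - A t = 0.
    schurˡ : t ^ a * detℤ K ≡ t ^ b * detℤ (λ i j → scalar (s * t) i j - sum (λ l → A i l * B l j))
    schurˡ = begin
      t ^ a * detℤ K
        ≡⟨ row-operations (multilinear-++ˡ det-multilinear bottom)
             (λ i l {r} eq → det-alternating (↑ˡ≢↑ʳ i l) (r Vector.++ bottom) λ x →
               trans (cong-app (++-↑ˡ r bottom i) x) (trans (eq x) (sym (cong-app (++-↑ʳ r bottom l) x))))
             t (λ i l → - A i l) top ⟨
      detℤ ((λ i x → t * top i x + sum (λ l → - A i l * bottom l x)) Vector.++ bottom)
        ≡⟨ multilinear-++ˡ det-multilinear bottom .resp-≗ (λ i → ++-elim {a} {b} _ (left i) (right i)) ⟩
      detℤ (block P zeros B (scalar t))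
        ≡⟨ det-block-lower P B t ⟩
      t ^ b * detℤ P ∎
      where
      open ≡-Reasoning
      P : Mat a a
      P i j = scalar (s * t) i j - sum (λ l → A i l * B l j)
      left : ∀ i j → t * top i (j ↑ˡ b) + sum (λ l → - A i l * bottom l (j ↑ˡ b)) ≡ beside P (zeros {a} {b}) i (j ↑ˡ b)
      left i j = begin
        t * top i (j ↑ˡ b) + sum (λ l → - A i l * bottom l (j ↑ˡ b))
          ≡⟨ cong₂ (λ y z → t * y + z) (++-↑ˡ (scalar s i) (A i) j)
               (sum-cong-≗ λ l → cong (- A i l *_) (++-↑ˡ (B l) (scalar t l) j)) ⟩
        t * scalar s i j + sum (λ l → - A i l * B l j)
          ≡⟨ cong₂ _+_ (trans (*-scalar t s i j) (cong (λ z → scalar z i j) (ℤ.*-comm t s))) (sum-neg (A i) (λ l → B l j)) ⟩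
        P i j
          ≡⟨ ++-↑ˡ (P i) (zeros {a} {b} i) j ⟨
        beside P zeros i (j ↑ˡ b) ∎
      right : ∀ i j → t * top i (a ↑ʳ j) + sum (λ l → - A i l * bottom l (a ↑ʳ j)) ≡ beside P (zeros {a} {b}) i (a ↑ʳ j)
      right i j = begin
        t * top i (a ↑ʳ j) + sum (λ l → - A i l * bottom l (a ↑ʳ j))
          ≡⟨ cong₂ (λ y z → t * y + z) (++-↑ʳ (scalar s i) (A i) j)
               (sum-cong-≗ λ l → cong (- A i l *_) (++-↑ʳ (B l) (scalar t l) j)) ⟩
        t * A i j + sum (λ l → - A i l * scalar t l j)
          ≡⟨ cong (t * A i j +_) (sum-scalar (λ l → - A i l) t j) ⟩
        t * A i j + - A i j * t
          ≡⟨ cancel t (A i j) ⟩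
        0ℤ
          ≡⟨ ++-↑ʳ (P i) (zeros {a} {b} i) j ⟨
        beside P zeros i (a ↑ʳ j) ∎
        where
        cancel : ∀ t x → t * x + - x * t ≡ 0ℤ
        cancel = solve-∀

    -- The mirror image: s bottom - B top clears the lower left block.
    schurʳ : s ^ b * detℤ K ≡ s ^ a * detℤ (λ i j → scalar (s * t) i j - sum (λ l → B i l * A l j))
    schurʳ = begin
      s ^ b * detℤ K
        ≡⟨ row-operations (multilinear-++ʳ det-multilinear top)
             (λ i l {r} eq → det-alternating (↑ˡ≢↑ʳ l i ∘ sym) (top Vector.++ r) λ x →
               trans (cong-app (++-↑ʳ top r i) x) (trans (eq x) (sym (cong-app (++-↑ˡ top r l) x))))
             s (λ i l → - B i l) bottom ⟨
      detℤ (top Vector.++ (λ i x → s * bottom i x + sum (λ l → - B i l * top l x)))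
        ≡⟨ multilinear-++ʳ det-multilinear top .resp-≗ (λ i → ++-elim {a} {b} _ (left i) (right i)) ⟩
      detℤ (block (scalar s) A zeros Q)
        ≡⟨ det-block-upper s A Q ⟩
      s ^ a * detℤ Q ∎
      where
      open ≡-Reasoning
      Q : Mat b b
      Q i j = scalar (s * t) i j - sum (λ l → B i l * A l j)
      left : ∀ i j → s * bottom i (j ↑ˡ b) + sum (λ l → - B i l * top l (j ↑ˡ b)) ≡ beside (zeros {b} {a}) Q i (j ↑ˡ b)
      left i j = begin
        s * bottom i (j ↑ˡ b) + sum (λ l → - B i l * top l (j ↑ˡ b))
          ≡⟨ cong₂ (λ y z → s * y + z) (++-↑ˡ (B i) (scalar t i) j)
               (sum-cong-≗ λ l → cong (- B i l *_) (++-↑ˡ (scalar s l) (A l) j)) ⟩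
        s * B i j + sum (λ l → - B i l * scalar s l j)
          ≡⟨ cong (s * B i j +_) (sum-scalar (λ l → - B i l) s j) ⟩
        s * B i j + - B i j * s
          ≡⟨ cancel s (B i j) ⟩
        0ℤ
          ≡⟨ ++-↑ˡ (zeros {b} {a} i) (Q i) j ⟨
        beside zeros Q i (j ↑ˡ b) ∎
        where
        cancel : ∀ t x → t * x + - x * t ≡ 0ℤ
        cancel = solve-∀
      right : ∀ i j → s * bottom i (a ↑ʳ j) + sum (λ l → - B i l * top l (a ↑ʳ j)) ≡ beside (zeros {b} {a}) Q i (a ↑ʳ j)
      right i j = begin
        s * bottom i (a ↑ʳ j) + sum (λ l → - B i l * top l (a ↑ʳ j))
          ≡⟨ cong₂ (λ y z → s * y + z) (++-↑ʳ (B i) (scalar t i) j)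
               (sum-cong-≗ λ l → cong (- B i l *_) (++-↑ʳ (scalar s l) (A l) j)) ⟩
        s * scalar t i j + sum (λ l → - B i l * A l j)
          ≡⟨ cong₂ _+_ (*-scalar s t i j) (sum-neg (B i) (λ l → A l j)) ⟩
        Q i j
          ≡⟨ ++-↑ʳ (zeros {b} {a} i) (Q i) j ⟨
        beside zeros Q i (a ↑ʳ j) ∎

  -- Both sides are t ^ a times the determinant of [ I , A ; B , t I ]. With s = 1 the elimination
  -- of `schurʳ` brings in no power at all.
  sylvester : ∀ t (A : Mat a b) (B : Mat b a) →
    t ^ b * detℤ (λ i j → scalar t i j - sum (λ l → A i l * B l j)) ≡
    t ^ a * detℤ (λ i j → scalar t i j - sum (λ l → B i l * A l j))
  sylvester {a} {b} t A B = begin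
    t ^ b * detℤ (λ i j → scalar t i j - sum (λ l → A i l * B l j))
      ≡⟨ cong (λ z → t ^ b * detℤ (λ i j → scalar z i j - sum (λ l → A i l * B l j))) (ℤ.*-identityˡ t) ⟨
    t ^ b * detℤ (λ i j → scalar (1ℤ * t) i j - sum (λ l → A i l * B l j))
      ≡⟨ schurˡ 1ℤ t A B ⟨
    t ^ a * K
      ≡⟨ cong (t ^ a *_) (trans (sym (ℤ.*-identityˡ K)) (trans (cong (_* K) (sym (ℤ.^-zeroˡ b))) (schurʳ 1ℤ t A B))) ⟩
    t ^ a * (1ℤ ^ a * detℤ (λ i j → scalar (1ℤ * t) i j - sum (λ l → B i l * A l j)))
      ≡⟨ cong₂ (λ y z → t ^ a * (y * detℤ (λ i j → scalar z i j - sum (λ l → B i l * A l j)))) (ℤ.^-zeroˡ a) (ℤ.*-identityˡ t) ⟩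
    t ^ a * (1ℤ * detℤ (λ i j → scalar t i j - sum (λ l → B i l * A l j)))
      ≡⟨ cong (t ^ a *_) (ℤ.*-identityˡ _) ⟩
    t ^ a * detℤ (λ i j → scalar t i j - sum (λ l → B i l * A l j)) ∎
    where
    open ≡-Reasoning
    K = detℤ (block (scalar 1ℤ) A B (scalar t))

-- Evaluation of polynomials, and equality from equality at large integers.

module Evaluation where

  open Determinant
  open import Data.Integer.Base using (ℤ; +_; 0ℤ; 1ℤ; _+_; _*_; _-_; -_; _^_; ∣_∣)

  open RawSemiringDefinitions (RawRing.rawSemiring ℤ[X]) using () renaming (sum to sumₚ; _^_ to _^ₚ_)

  eval : Poly → ℤ → ℤ
  eval []      x = 0ℤ
  eval (a ∷ p) x = a + x * eval p x

  module _ (x : ℤ) where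

    eval-+ : ∀ p q → eval (p +ₚ q) x ≡ eval p x + eval q x
    eval-+ []      q       = sym (ℤ.+-identityˡ (eval q x))
    eval-+ (a ∷ p) []      = sym (ℤ.+-identityʳ (eval (a ∷ p) x))
    eval-+ (a ∷ p) (b ∷ q) = trans (cong (λ z → a + b + x * z) (eval-+ p q)) (collect a b x (eval p x) (eval q x))
      where
      collect : ∀ a b x p q → a + b + x * (p + q) ≡ a + x * p + (b + x * q)
      collect = solve-∀

    eval-scale : ∀ a q → eval (List.map (a *_) q) x ≡ a * eval q x
    eval-scale a []      = sym (ℤ.*-zeroʳ a)
    eval-scale a (b ∷ q) = trans (cong (λ z → a * b + x * z) (eval-scale a q)) (collect a b x (eval q x))
      where
      collect : ∀ a b x q → a * b + x * (a * q) ≡ a * (b + x * q)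
      collect = solve-∀

    eval-* : ∀ p q → eval (p *ₚ q) x ≡ eval p x * eval q x
    eval-* []      q = refl
    eval-* (a ∷ p) q = trans (eval-+ (List.map (a *_) q) (0ℤ ∷ (p *ₚ q)))
      (trans (cong₂ (λ y z → y + (0ℤ + x * z)) (eval-scale a q) (eval-* p q)) (collect a x (eval p x) (eval q x)))
      where
      collect : ∀ a x p q → a * q + (0ℤ + x * (p * q)) ≡ (a + x * p) * q
      collect = solve-∀

    eval-neg : ∀ p → eval (-ₚ p) x ≡ - eval p x
    eval-neg []      = refl
    eval-neg (a ∷ p) = trans (cong (λ z → - a + x * z) (eval-neg p)) (collect a x (eval p x))
      where
      collect : ∀ a x p → - a + x * - p ≡ - (a + x * p)
      collect = solve-∀

    eval-const : ∀ a → eval (const a) x ≡ a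
    eval-const a = trans (cong (λ z → a + z) (ℤ.*-zeroʳ x)) (ℤ.+-identityʳ a)

    eval-X : eval X x ≡ x
    eval-X = simp x
      where
      simp : ∀ x → 0ℤ + x * (1ℤ + x * 0ℤ) ≡ x
      simp = solve-∀

    eval-sum : ∀ {n} (f : Fin n → Poly) → eval (sumₚ f) x ≡ sum (λ i → eval (f i) x)
    eval-sum {zero}  f = refl
    eval-sum {suc n} f = trans (eval-+ (f zero) (sumₚ (f ∘ suc))) (cong (λ z → eval (f zero) x + z) (eval-sum (f ∘ suc)))

    eval-sign : ∀ m → eval ((-ₚ const 1ℤ) ^ₚ m) x ≡ (- 1ℤ) ^ˢ m
    eval-sign zero    = eval-const 1ℤ
    eval-sign (suc m) = trans (eval-* (-ₚ const 1ℤ) ((-ₚ const 1ℤ) ^ₚ m)) (cong₂ _*_ (eval-const (- 1ℤ)) (eval-sign m))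

    eval-det : ∀ {n} (M : Matrix Poly n) → eval (det ℤ[X] M) x ≡ detℤ (λ i j → eval (M i j) x)
    eval-det {zero}  M = eval-const 1ℤ
    eval-det {suc n} M = trans (eval-sum λ j → ((-ₚ const 1ℤ) ^ₚ toℕ j) *ₚ (M zero j *ₚ D j)) (sum-cong-≗ term)
      where
      D : Fin (suc n) → Poly
      D j = det ℤ[X] (λ i → Vector.removeAt (M (suc i)) j)
      term : ∀ j → eval (((-ₚ const 1ℤ) ^ₚ toℕ j) *ₚ (M zero j *ₚ D j)) x
                 ≡ sgn j * (eval (M zero j) x * detℤ (minor (λ i j → eval (M i j) x) j))
      term j = trans (eval-* ((-ₚ const 1ℤ) ^ₚ toℕ j) (M zero j *ₚ D j)) (cong₂ _*_ (eval-sign (toℕ j))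
        (trans (eval-* (M zero j) (D j)) (cong (λ z → eval (M zero j) x * z) (eval-det (λ i → Vector.removeAt (M (suc i)) j)))))

    eval-charPoly : ∀ {n} (M : Matrix ℤ n) → eval (charPoly M) x ≡ detℤ (λ i j → scalar x i j - M i j)
    eval-charPoly M = trans (eval-det λ i j → (if does (i Fin.≟ j) then X else []) +ₚ (-ₚ const (M i j))) (det-cong entry)
      where
      entry : ∀ i j → eval ((if does (i Fin.≟ j) then X else []) +ₚ (-ₚ const (M i j))) x ≡ scalar x i j - M i j
      entry i j = trans (eval-+ (if does (i Fin.≟ j) then X else []) (-ₚ const (M i j)))
        (cong₂ _+_ (diagonal (does (i Fin.≟ j))) (eval-const (- M i j)))
        where
        diagonal : ∀ b → eval (if b then X else []) x ≡ (if b then x else 0ℤ)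
        diagonal true  = eval-X
        diagonal false = refl

    rootProduct : List ℤ → ℤ
    rootProduct = List.foldr (λ r z → (x - r) * z) 1ℤ

    eval-fromRoots : ∀ rs → eval (fromRoots rs) x ≡ rootProduct rs
    eval-fromRoots []       = eval-const 1ℤ
    eval-fromRoots (r ∷ rs) = trans (eval-* (X +ₚ (-ₚ const r)) (fromRoots rs))
      (cong₂ _*_ (trans (eval-+ X (-ₚ const r)) (cong₂ _+_ eval-X (eval-const (- r)))) (eval-fromRoots rs))

    ∏-++ : ∀ rs ss → rootProduct (rs List.++ ss) ≡ rootProduct rs * rootProduct ss
    ∏-++ []       ss = sym (ℤ.*-identityˡ _)
    ∏-++ (r ∷ rs) ss = trans (cong (λ z → (x - r) * z) (∏-++ rs ss)) (sym (ℤ.*-assoc (x - r) (rootProduct rs) (rootProduct ss)))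

    ∏-replicate : ∀ m r → rootProduct (List.replicate m r) ≡ (x - r) ^ m
    ∏-replicate zero    r = refl
    ∏-replicate (suc m) r = cong ((x - r) *_) (∏-replicate m r)

  -- A polynomial a₀ + X q vanishing at all large x has a₀ divisible by all large x.
  eventually-zero⇒zero : ∀ N p → (∀ x → N ℕ.≤ x → eval p (+ x) ≡ 0ℤ) → ∀ i → coeff p i ≡ 0ℤ
  eventually-zero⇒zero N []      vanish i = refl
  eventually-zero⇒zero N (a ∷ p) vanish = λ { zero → a≡0 ; (suc i) → eventually-zero⇒zero (suc N) p tail-vanish i }
    where
    open ≡-Reasoning
    -- At least N, so `vanish` applies, and greater than ∣ a ∣, so the only multiple of it that can
    -- equal ∣ a ∣ is 0.
    large : ℕ
    large = N ℕ.+ suc ∣ a ∣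
    split : ∀ x → N ℕ.≤ x → a ≡ - (+ x * eval p (+ x))
    split x N≤x = trans (solveFor a (+ x * eval p (+ x))) (trans (cong (_- (+ x * eval p (+ x))) (vanish x N≤x)) (ℤ.+-identityˡ _))
      where
      solveFor : ∀ a y → a ≡ a + y - y
      solveFor = solve-∀
    ∣a∣≡ : ∣ a ∣ ≡ large ℕ.* ∣ eval p (+ large) ∣
    ∣a∣≡ = begin
      ∣ a ∣                             ≡⟨ cong ∣_∣ (split large (ℕ.m≤m+n N _)) ⟩
      ∣ - (+ large * eval p (+ large)) ∣ ≡⟨ ℤ.∣-i∣≡∣i∣ (+ large * eval p (+ large)) ⟩
      ∣ + large * eval p (+ large) ∣     ≡⟨ ℤ.abs-* (+ large) (eval p (+ large)) ⟩
      large ℕ.* ∣ eval p (+ large) ∣     ∎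
    too-large : ∀ e → ∣ a ∣ ≡ large ℕ.* e → ∣ a ∣ ≡ 0
    too-large zero    eq = trans eq (ℕ.*-zeroʳ large)
    too-large (suc e) eq = contradiction (ℕ.≤-trans (ℕ.m≤n+m (suc ∣ a ∣) N) (ℕ.≤-trans (ℕ.m≤m*n large (suc e)) (ℕ.≤-reflexive (sym eq)))) (ℕ.n≮n ∣ a ∣)
    a≡0 : a ≡ 0ℤ
    a≡0 = ℤ.∣i∣≡0⇒i≡0 (too-large ∣ eval p (+ large) ∣ ∣a∣≡)
    -- The bound `suc N` keeps x non-zero, which allows cancelling it from x q(x) = 0.
    tail-vanish : ∀ x → suc N ℕ.≤ x → eval p (+ x) ≡ 0ℤ
    tail-vanish (suc x) N<x with ℤ.i*j≡0⇒i≡0∨j≡0 (+ suc x) {eval p (+ suc x)}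
      (trans (sym (ℤ.+-identityˡ _)) (trans (cong (_+ (+ suc x * eval p (+ suc x))) (sym a≡0)) (vanish (suc x) (ℕ.<⇒≤ N<x))))
    ... | inj₂ eq = eq

  coeff-+ : ∀ p q i → coeff (p +ₚ q) i ≡ coeff p i + coeff q i
  coeff-+ []      q       i       = sym (ℤ.+-identityˡ _)
  coeff-+ (a ∷ p) []      i       = sym (ℤ.+-identityʳ _)
  coeff-+ (a ∷ p) (b ∷ q) zero    = refl
  coeff-+ (a ∷ p) (b ∷ q) (suc i) = coeff-+ p q i

  coeff-neg : ∀ p i → coeff (-ₚ p) i ≡ - coeff p i
  coeff-neg []      i       = refl
  coeff-neg (a ∷ p) zero    = refl
  coeff-neg (a ∷ p) (suc i) = coeff-neg p i

  eventually-equal⇒≈ : ∀ N p q → (∀ x → N ℕ.≤ x → eval p (+ x) ≡ eval q (+ x)) → p ≈ₚ q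
  eventually-equal⇒≈ N p q agree i = ℤ.i-j≡0⇒i≡j (coeff p i) (coeff q i) (begin
    coeff p i - coeff q i         ≡⟨ cong (λ z → coeff p i + z) (coeff-neg q i) ⟨
    coeff p i + coeff (-ₚ q) i    ≡⟨ coeff-+ p (-ₚ q) i ⟨
    coeff (p +ₚ (-ₚ q)) i         ≡⟨ eventually-zero⇒zero N (p +ₚ (-ₚ q)) difference i ⟩
    0ℤ                            ∎)
    where
    open ≡-Reasoning
    difference : ∀ x → N ℕ.≤ x → eval (p +ₚ (-ₚ q)) (+ x) ≡ 0ℤ
    difference x N≤x = trans (eval-+ (+ x) p (-ₚ q)) (trans (cong₂ _+_ (agree x N≤x) (eval-neg (+ x) q)) (ℤ.+-inverseʳ (eval q (+ x))))

-- Counting in the Boolean lattice by sums of indicators.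

module BooleanLattice where

  open Determinant
  open import Data.Fin.Subset using (∣_∣)
  open import Data.Integer.Base using (ℤ; +_; 0ℤ; 1ℤ; _+_; _*_; _-_; -_)

  private variable
    n : ℕ
    A B : Set
    P Q : Set

  𝟙 : Dec P → ℤ
  𝟙 P? = if does P? then 1ℤ else 0ℤ

  𝟙-yes : (P? : Dec P) → P → 𝟙 P? ≡ 1ℤ
  𝟙-yes (yes _) p = refl
  𝟙-yes (no ¬p) p = contradiction p ¬p

  𝟙-no : (P? : Dec P) → ¬ P → 𝟙 P? ≡ 0ℤ
  𝟙-no (yes p) ¬p = contradiction p ¬p
  𝟙-no (no _)  ¬p = refl

  𝟙-cong : (P? : Dec P) (Q? : Dec Q) → (P → Q) → (Q → P) → 𝟙 P? ≡ 𝟙 Q?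
  𝟙-cong (yes p) Q? f g = sym (𝟙-yes Q? (f p))
  𝟙-cong (no ¬p) Q? f g = sym (𝟙-no Q? (¬p ∘ g))

  ∑ : List A → (A → ℤ) → ℤ
  ∑ []       f = 0ℤ
  ∑ (x ∷ xs) f = f x + ∑ xs f

  ∑-cong : ∀ (xs : List A) {f g : A → ℤ} → (∀ x → f x ≡ g x) → ∑ xs f ≡ ∑ xs g
  ∑-cong []       eq = refl
  ∑-cong (x ∷ xs) eq = cong₂ _+_ (eq x) (∑-cong xs eq)

  ∑-zero : ∀ (xs : List A) {f : A → ℤ} → (∀ x → f x ≡ 0ℤ) → ∑ xs f ≡ 0ℤ
  ∑-zero []       eq = refl
  ∑-zero (x ∷ xs) eq = cong₂ _+_ (eq x) (∑-zero xs eq)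

  ∑-++ : ∀ (xs ys : List A) {f : A → ℤ} → ∑ (xs List.++ ys) f ≡ ∑ xs f + ∑ ys f
  ∑-++ []       ys     = sym (ℤ.+-identityˡ _)
  ∑-++ (x ∷ xs) ys {f} = trans (cong (λ z → f x + z) (∑-++ xs ys)) (sym (ℤ.+-assoc (f x) _ _))

  ∑-map : ∀ (h : A → B) (xs : List A) {f : B → ℤ} → ∑ (List.map h xs) f ≡ ∑ xs (f ∘ h)
  ∑-map h []           = refl
  ∑-map h (x ∷ xs) {f} = cong (λ z → f (h x) + z) (∑-map h xs)

  ∑-filter : ∀ {S : Pred A 0ℓ} (S? : Decidable S) (xs : List A) {f : A → ℤ} →
             ∑ (filter S? xs) f ≡ ∑ xs (λ x → 𝟙 (S? x) * f x)
  ∑-filter S? []           = refl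
  ∑-filter S? (x ∷ xs) {f} with does (S? x)
  ... | true  = cong₂ _+_ (sym (ℤ.*-identityˡ (f x))) (∑-filter S? xs)
  ... | false = trans (∑-filter S? xs) (sym (ℤ.+-identityˡ _))

  ∑-+ : ∀ (xs : List A) (f g : A → ℤ) → ∑ xs (λ x → f x + g x) ≡ ∑ xs f + ∑ xs g
  ∑-+ []       f g = refl
  ∑-+ (x ∷ xs) f g = trans (cong (λ z → f x + g x + z) (∑-+ xs f g)) (interchange (f x) (g x) (∑ xs f) (∑ xs g))
    where
    interchange : ∀ a b c d → a + b + (c + d) ≡ a + c + (b + d)
    interchange = solve-∀

  *-distribˡ-∑ : ∀ c (xs : List A) {f : A → ℤ} → c * ∑ xs f ≡ ∑ xs (λ x → c * f x)
  *-distribˡ-∑ c []           = ℤ.*-zeroʳ c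
  *-distribˡ-∑ c (x ∷ xs) {f} = trans (ℤ.*-distribˡ-+ c (f x) (∑ xs f)) (cong (λ z → c * f x + z) (*-distribˡ-∑ c xs))

  ∑-cong-∈ : ∀ (xs : List A) {f g : A → ℤ} → (∀ x → x ∈ xs → f x ≡ g x) → ∑ xs f ≡ ∑ xs g
  ∑-cong-∈ []       eq = refl
  ∑-cong-∈ (x ∷ xs) eq = cong₂ _+_ (eq x (here refl)) (∑-cong-∈ xs λ y y∈ → eq y (there y∈))

  ∑-comm-∑ : ∀ (xs : List A) (ys : List B) {f : A → B → ℤ} →
    ∑ xs (λ x → ∑ ys (f x)) ≡ ∑ ys (λ y → ∑ xs (λ x → f x y))
  ∑-comm-∑ []       ys     = sym (∑-zero ys λ _ → refl)
  ∑-comm-∑ (x ∷ xs) ys {f} = trans (cong (λ z → ∑ ys (f x) + z) (∑-comm-∑ xs ys)) (sym (∑-+ ys (f x) _))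

  ∑-length : ∀ (xs : List A) → ∑ xs (λ _ → 1ℤ) ≡ + length xs
  ∑-length []       = refl
  ∑-length (x ∷ xs) = cong (λ z → 1ℤ + z) (∑-length xs)

  -- The passage from matrix products, summed over positions, to sums over the listed sets or edges.
  sum-lookup : ∀ (xs : List A) (f : A → ℤ) → sum (λ i → f (lookup xs i)) ≡ ∑ xs f
  sum-lookup []       f = refl
  sum-lookup (x ∷ xs) f = cong (λ z → f x + z) (sum-lookup xs f)

  module _ (_≟_ : DecidableEquality A) where

    ∑-𝟙≟ : ∀ {xs} → Unique xs → ∀ {x} → x ∈ xs → (f : A → ℤ) → ∑ xs (λ y → 𝟙 (x ≟ y) * f y) ≡ f x
    ∑-𝟙≟ {y ∷ xs} (y∉xs ∷ xs!) {x} (here refl) f = begin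
      𝟙 (x ≟ x) * f x + ∑ xs (λ y → 𝟙 (x ≟ y) * f y)
        ≡⟨ cong₂ _+_ (cong (_* f x) (𝟙-yes (x ≟ x) refl)) (vanish xs y∉xs) ⟩
      1ℤ * f x + 0ℤ
        ≡⟨ trans (ℤ.+-identityʳ _) (ℤ.*-identityˡ (f x)) ⟩
      f x ∎
      where
      open ≡-Reasoning
      vanish : ∀ ys → All.All (x ≢_) ys → ∑ ys (λ y → 𝟙 (x ≟ y) * f y) ≡ 0ℤ
      vanish []       All.[]          = refl
      vanish (y ∷ ys) (x≢y All.∷ x∉ys) = cong₂ _+_ (cong (_* f y) (𝟙-no (x ≟ y) x≢y)) (vanish ys x∉ys)
    ∑-𝟙≟ {y ∷ xs} (y∉xs ∷ xs!) {x} (there x∈xs) f = trans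
      (cong₂ _+_ (cong (_* f y) (𝟙-no (x ≟ y) (All.lookup y∉xs x∈xs ∘ sym))) (∑-𝟙≟ xs! x∈xs f))
      (ℤ.+-identityˡ (f x))

    lookup-injective : ∀ {xs : List A} → Unique xs → ∀ i j → lookup xs i ≡ lookup xs j → i ≡ j
    lookup-injective (_    ∷ _)   zero    zero    eq = refl
    lookup-injective (x∉xs ∷ _)   zero    (suc j) eq = contradiction eq (All.lookup x∉xs (∈-lookup j))
    lookup-injective (x∉xs ∷ _)   (suc i) zero    eq = contradiction (sym eq) (All.lookup x∉xs (∈-lookup i))
    lookup-injective (_    ∷ xs!) (suc i) (suc j) eq = cong suc (lookup-injective xs! i j eq)

    -- Positions can be traded for listed elements because the list has no repetition; the
    -- combinatorial identities speak of the elements only.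
    scalar-lookup : ∀ {xs : List A} → Unique xs → ∀ t i j → scalar t i j ≡ t * 𝟙 (lookup xs i ≟ lookup xs j)
    scalar-lookup {xs} xs! t i j with i Fin.≟ j
    ... | yes refl = sym (trans (cong (t *_) (𝟙-yes (lookup xs i ≟ lookup xs i) refl)) (ℤ.*-identityʳ t))
    ... | no i≢j   = sym (trans (cong (t *_) (𝟙-no (lookup xs i ≟ lookup xs j) (i≢j ∘ lookup-injective xs! i j))) (ℤ.*-zeroʳ t))

  infix 4 _≟ˢ_

  _≟ˢ_ : DecidableEquality (Subset n)
  _≟ˢ_ = Vec.≡-dec Bool._≟_

  δ : Subset n → Subset n → ℤ
  δ p q = 𝟙 (p ≟ˢ q)

  δ-refl : (p : Subset n) → δ p p ≡ 1ℤ
  δ-refl p = 𝟙-yes (p ≟ˢ p) refl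

  δ-sym : (p q : Subset n) → δ p q ≡ δ q p
  δ-sym p q = 𝟙-cong (p ≟ˢ q) (q ≟ˢ p) sym sym

  δ-∷ : ∀ b (p q : Subset n) → δ (b Vec.∷ p) (b Vec.∷ q) ≡ δ p q
  δ-∷ b p q = 𝟙-cong (b Vec.∷ p ≟ˢ b Vec.∷ q) (p ≟ˢ q) Vec.∷-injectiveʳ (cong (b Vec.∷_))

  -- The 0/1 matrix of the covering relation: q is p with one element added. The recursion on the
  -- first coordinate matches `∑-subsets`, so identities for sums over all subsets follow by
  -- induction on n.
  cover : Subset n → Subset n → ℤ
  cover Vec.[]              Vec.[]              = 0ℤ
  cover (outside Vec.∷ p) (outside Vec.∷ q) = cover p q
  cover (outside Vec.∷ p) (inside Vec.∷ q)  = δ p q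
  cover (inside Vec.∷ p)  (outside Vec.∷ q) = 0ℤ
  cover (inside Vec.∷ p)  (inside Vec.∷ q)  = cover p q

  cover-rank : (p q : Subset n) → suc ∣ p ∣ ≢ ∣ q ∣ → cover p q ≡ 0ℤ
  cover-rank Vec.[]              Vec.[]              ≢ = refl
  cover-rank (outside Vec.∷ p) (outside Vec.∷ q) ≢ = cover-rank p q ≢
  cover-rank (outside Vec.∷ p) (inside Vec.∷ q)  ≢ = 𝟙-no (p ≟ˢ q) λ { refl → ≢ refl }
  cover-rank (inside Vec.∷ p)  (outside Vec.∷ q) ≢ = refl
  cover-rank (inside Vec.∷ p)  (inside Vec.∷ q)  ≢ = cover-rank p q (≢ ∘ cong suc)

  cover-irrefl : (p : Subset n) → cover p p ≡ 0ℤ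
  cover-irrefl p = cover-rank p p ℕ.1+n≢n

  ∣△∣≡0⇒≡ : (p q : Subset n) → ∣ p △ q ∣ ≡ 0 → p ≡ q
  ∣△∣≡0⇒≡ Vec.[]              Vec.[]              eq = refl
  ∣△∣≡0⇒≡ (outside Vec.∷ p) (outside Vec.∷ q) eq = cong (outside Vec.∷_) (∣△∣≡0⇒≡ p q eq)
  ∣△∣≡0⇒≡ (inside Vec.∷ p)  (inside Vec.∷ q)  eq = cong (inside Vec.∷_) (∣△∣≡0⇒≡ p q eq)

  ∣p△p∣≡0 : (p : Subset n) → ∣ p △ p ∣ ≡ 0
  ∣p△p∣≡0 Vec.[]            = refl
  ∣p△p∣≡0 (outside Vec.∷ p) = ∣p△p∣≡0 p
  ∣p△p∣≡0 (inside Vec.∷ p)  = ∣p△p∣≡0 p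

  -- If the first coordinates differ, the remaining ones must agree, and the coordinate that holds
  -- `inside` decides which of the two summands is 1.
  adjacent-cover : (p q : Subset n) → 𝟙 (∣ p △ q ∣ ℕ.≟ 1) ≡ cover p q + cover q p
  adjacent-cover Vec.[]            Vec.[]            = refl
  adjacent-cover (outside Vec.∷ p) (outside Vec.∷ q) = adjacent-cover p q
  adjacent-cover (outside Vec.∷ p) (inside Vec.∷ q)  = trans
    (𝟙-cong (∣ p △ q ∣ ℕ.≟ 0) (p ≟ˢ q) (∣△∣≡0⇒≡ p q) λ { refl → ∣p△p∣≡0 p })
    (sym (ℤ.+-identityʳ (δ p q)))
  adjacent-cover (inside Vec.∷ p)  (outside Vec.∷ q) = trans
    (𝟙-cong (∣ p △ q ∣ ℕ.≟ 0) (q ≟ˢ p) (sym ∘ ∣△∣≡0⇒≡ p q) λ { refl → ∣p△p∣≡0 p })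
    (sym (ℤ.+-identityˡ (δ q p)))
  adjacent-cover (inside Vec.∷ p)  (inside Vec.∷ q)  = adjacent-cover p q

  ∑-subsets : (f : Subset (suc n) → ℤ) →
    ∑ (subsets (suc n)) f ≡ ∑ (subsets n) (λ p → f (outside Vec.∷ p)) + ∑ (subsets n) (λ p → f (inside Vec.∷ p))
  ∑-subsets {n} f = trans (∑-++ (List.map (outside Vec.∷_) (subsets n)) _)
    (cong₂ _+_ (∑-map (outside Vec.∷_) (subsets n)) (∑-map (inside Vec.∷_) (subsets n)))

  ∑-δ : (p : Subset n) (f : Subset n → ℤ) → ∑ (subsets n) (λ q → δ p q * f q) ≡ f p
  ∑-δ {n} p f = ∑-𝟙≟ _≟ˢ_ (Graph.unique (BL n)) (∈-subsets p) f

  -- The entries of D U (`up`) and of U D (`down`). Summing over all subsets is harmless, as `cover`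
  -- already selects the layer.
  up down : Subset n → Subset n → ℤ
  up   {n} p q = ∑ (subsets n) (λ w → cover p w * cover q w)
  down {n} p q = ∑ (subsets n) (λ v → cover v p * cover v q)

  ∑-δˡ : (p : Subset n) (f : Subset n → ℤ) → ∑ (subsets n) (λ q → δ q p * f q) ≡ f p
  ∑-δˡ {n} p f = trans (∑-cong (subsets n) λ q → cong (_* f q) (δ-sym q p)) (∑-δ p f)

  ∑-δʳ : (p : Subset n) (f : Subset n → ℤ) → ∑ (subsets n) (λ q → f q * δ p q) ≡ f p
  ∑-δʳ {n} p f = trans (∑-cong (subsets n) λ q → ℤ.*-comm (f q) (δ p q)) (∑-δ p f)

  -- The commutation relation DU - UD = (n - 2|p|) I of the Boolean lattice.
  up-down : (p q : Subset n) → up p q + + ∣ p ∣ * δ p q ≡ down p q + (+ n - + ∣ p ∣) * δ p q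
  up-down Vec.[] Vec.[] = refl
  -- Equal first coordinates create one extra δ: in `up` when both are `outside`, matched by the
  -- growth of n, and in `down` when both are `inside`, matched by the growth of ∣ p ∣.
  up-down {suc n} (outside Vec.∷ p) (outside Vec.∷ q) = begin
    up (outside Vec.∷ p) (outside Vec.∷ q) + + ∣ p ∣ * δ (outside Vec.∷ p) (outside Vec.∷ q)
      ≡⟨ cong₂ (λ y z → y + + ∣ p ∣ * z) (trans (∑-subsets {n} _) (cong (λ z → up p q + z) (trans (∑-δ p (δ q)) (δ-sym q p))))
           (δ-∷ outside p q) ⟩
    up p q + δ p q + + ∣ p ∣ * δ p q
      ≡⟨ shuffle (up p q) (δ p q) (+ ∣ p ∣) ⟩
    (up p q + + ∣ p ∣ * δ p q) + δ p q
      ≡⟨ cong (_+ δ p q) (up-down p q) ⟩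
    (down p q + (+ n - + ∣ p ∣) * δ p q) + δ p q
      ≡⟨ regroup (down p q) (+ n) (+ ∣ p ∣) (δ p q) ⟩
    down p q + 0ℤ + (1ℤ + + n - + ∣ p ∣) * δ p q
      ≡⟨ cong₂ (λ y z → y + (+ suc n - + ∣ p ∣) * z) (trans (∑-subsets {n} _) (cong (λ z → down p q + z) (∑-zero (subsets n) λ _ → refl)))
           (δ-∷ outside p q) ⟨
    down (outside Vec.∷ p) (outside Vec.∷ q) + (+ suc n - + ∣ p ∣) * δ (outside Vec.∷ p) (outside Vec.∷ q) ∎
    where
    open ≡-Reasoning
    shuffle : ∀ u d a → u + d + a * d ≡ (u + a * d) + d
    shuffle = solve-∀
    regroup : ∀ e n a d → (e + (n - a) * d) + d ≡ e + 0ℤ + (1ℤ + n - a) * d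
    regroup = solve-∀
  up-down {suc n} (inside Vec.∷ p) (inside Vec.∷ q) = begin
    up (inside Vec.∷ p) (inside Vec.∷ q) + (1ℤ + + ∣ p ∣) * δ (inside Vec.∷ p) (inside Vec.∷ q)
      ≡⟨ cong₂ (λ y z → y + (1ℤ + + ∣ p ∣) * z) (trans (∑-subsets {n} _) (cong (_+ up p q) (∑-zero (subsets n) λ _ → refl)))
           (δ-∷ inside p q) ⟩
    0ℤ + up p q + (1ℤ + + ∣ p ∣) * δ p q
      ≡⟨ shuffle (up p q) (δ p q) (+ ∣ p ∣) ⟩
    (up p q + + ∣ p ∣ * δ p q) + δ p q
      ≡⟨ cong (_+ δ p q) (up-down p q) ⟩
    (down p q + (+ n - + ∣ p ∣) * δ p q) + δ p q
      ≡⟨ regroup (down p q) (+ n) (+ ∣ p ∣) (δ p q) ⟩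
    δ p q + down p q + (1ℤ + + n - (1ℤ + + ∣ p ∣)) * δ p q
      ≡⟨ cong₂ (λ y z → y + (+ suc n - + suc ∣ p ∣) * z) (trans (∑-subsets {n} _) (cong (_+ down p q) (∑-δˡ p (λ v → δ v q))))
           (δ-∷ inside p q) ⟨
    down (inside Vec.∷ p) (inside Vec.∷ q) + (+ suc n - + suc ∣ p ∣) * δ (inside Vec.∷ p) (inside Vec.∷ q) ∎
    where
    open ≡-Reasoning
    shuffle : ∀ u d a → 0ℤ + u + (1ℤ + a) * d ≡ (u + a * d) + d
    shuffle = solve-∀
    regroup : ∀ e n a d → (e + (n - a) * d) + d ≡ d + e + (1ℤ + n - (1ℤ + a)) * d
    regroup = solve-∀
  -- For different first coordinates δ vanishes, and each of `up` and `down` keeps one half of its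
  -- sum; both halves collapse to `cover q p`.
  up-down {suc n} (outside Vec.∷ p) (inside Vec.∷ q) = cong₂ _+_
    (trans
      (trans (∑-subsets {n} _) (cong₂ _+_ (∑-zero (subsets n) λ w → ℤ.*-zeroʳ (cover p w)) (∑-δ p (cover q))))
      (sym (trans (trans (∑-subsets {n} _) (cong₂ _+_ (∑-δʳ′ p) (∑-zero (subsets n) λ _ → refl)))
        (ℤ.+-comm (cover q p) 0ℤ))))
    (trans (ℤ.*-zeroʳ (+ ∣ p ∣)) (sym (ℤ.*-zeroʳ (+ suc n - + ∣ p ∣))))
    where
    ∑-δʳ′ : ∀ p → ∑ (subsets n) (λ v → cover v p * δ v q) ≡ cover q p
    ∑-δʳ′ p = trans (∑-cong (subsets n) λ v → cong (cover v p *_) (δ-sym v q)) (∑-δʳ q (λ v → cover v p))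
  up-down {suc n} (inside Vec.∷ p) (outside Vec.∷ q) = cong₂ _+_
    (trans
      (trans (∑-subsets {n} _) (cong₂ _+_ (∑-zero (subsets n) λ _ → refl) (∑-δʳ q (cover p))))
      (sym (trans (trans (∑-subsets {n} _) (cong₂ _+_ (∑-δˡ p (λ v → cover v q)) (∑-zero (subsets n) λ v → ℤ.*-zeroʳ (cover v p))))
        (ℤ.+-comm (cover p q) 0ℤ))))
    (trans (ℤ.*-zeroʳ (+ suc ∣ p ∣)) (sym (ℤ.*-zeroʳ (+ suc n - + suc ∣ p ∣))))

  up-degree : (p : Subset n) → ∑ (subsets n) (cover p) ≡ + n - + ∣ p ∣
  up-degree Vec.[] = refl
  up-degree {suc n} (outside Vec.∷ p) = trans (∑-subsets {n} _) (trans
    (cong₂ _+_ (up-degree p) (trans (∑-cong (subsets n) λ q → sym (ℤ.*-identityʳ (δ p q))) (∑-δ p λ _ → 1ℤ)))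
    (shuffle (+ n) (+ ∣ p ∣)))
    where
    shuffle : ∀ n a → n - a + 1ℤ ≡ 1ℤ + n - a
    shuffle = solve-∀
  up-degree {suc n} (inside Vec.∷ p) = trans (∑-subsets {n} _) (trans
    (cong₂ _+_ (∑-zero (subsets n) λ _ → refl) (up-degree p))
    (shuffle (+ n) (+ ∣ p ∣)))
    where
    shuffle : ∀ n a → 0ℤ + (n - a) ≡ 1ℤ + n - (1ℤ + a)
    shuffle = solve-∀

  down-degree : (q : Subset n) → ∑ (subsets n) (λ p → cover p q) ≡ + ∣ q ∣
  down-degree Vec.[] = refl
  down-degree {suc n} (outside Vec.∷ q) = trans (∑-subsets {n} _) (trans
    (cong₂ _+_ (down-degree q) (∑-zero (subsets n) λ _ → refl)) (ℤ.+-identityʳ _))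
  down-degree {suc n} (inside Vec.∷ q) = trans (∑-subsets {n} _)
    (cong₂ _+_ (trans (∑-cong (subsets n) λ p → sym (ℤ.*-identityʳ (δ p q))) (∑-δˡ q λ _ → 1ℤ)) (down-degree q))

  layer : ∀ n → ℕ → List (Subset n)
  layer n j = filter (λ p → ∣ p ∣ ℕ.≟ j) (subsets n)

  layer-unique : ∀ n j → Unique (layer n j)
  layer-unique n j = Unique.filter⁺ (λ p → ∣ p ∣ ℕ.≟ j) (Graph.unique (BL n))

  lookup-layer : ∀ n j i → ∣ lookup (layer n j) i ∣ ≡ j
  lookup-layer n j i = proj₂ (∈-filter⁻ (λ p → ∣ p ∣ ℕ.≟ j) {xs = subsets n} (∈-lookup i))

  ∈-layer : ∀ {n j} (p : Subset n) → ∣ p ∣ ≡ j → p ∈ layer n j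
  ∈-layer {n} {j} p eq = ∈-filter⁺ (λ p → ∣ p ∣ ℕ.≟ j) (∈-subsets p) eq

  -- Moves a sum from one layer to all subsets, where induction on n is available.
  ∑-layer : ∀ n j {f : Subset n → ℤ} → (∀ p → ∣ p ∣ ≢ j → f p ≡ 0ℤ) → ∑ (layer n j) f ≡ ∑ (subsets n) f
  ∑-layer n j {f} off = trans (∑-filter (λ p → ∣ p ∣ ℕ.≟ j) (subsets n)) (∑-cong (subsets n) λ p → term p (∣ p ∣ ℕ.≟ j))
    where
    term : ∀ p (d : Dec (∣ p ∣ ≡ j)) → 𝟙 d * f p ≡ f p
    term p (yes _) = ℤ.*-identityˡ (f p)
    term p (no ≢j) = sym (off p ≢j)

  nC0≡1 : ∀ n → n Comb.C 0 ≡ 1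
  nC0≡1 n = trans (cong (n Comb.C_) (sym (ℕ.n∸n≡0 n))) (trans (sym (nCk≡nC[n∸k] (ℕ.≤-refl {n}))) (nCn≡1 n))

  -- Splitting the indicator sum by the first coordinate is Pascal's rule.
  length-layer : ∀ n j → length (layer n j) ≡ n Comb.C j
  length-layer n j = ℤ.+-injective (trans (sym (∑-length (layer n j)))
    (trans (∑-filter (λ p → ∣ p ∣ ℕ.≟ j) (subsets n)) (trans (∑-cong (subsets n) λ p → ℤ.*-identityʳ _) (count n j))))
    where
    count : ∀ n j → ∑ (subsets n) (λ p → 𝟙 (∣ p ∣ ℕ.≟ j)) ≡ + (n Comb.C j)
    count zero    zero    = refl
    count zero    (suc j) = refl
    count (suc n) zero    = trans (∑-subsets {n} _) (trans (cong₂ _+_ (count n 0) (∑-zero (subsets n) λ _ → refl))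
      (trans (ℤ.+-identityʳ _) (cong (λ m → + m) (trans (nC0≡1 n) (sym (nC0≡1 (suc n)))))))
    count (suc n) (suc j) = trans (∑-subsets {n} _) (trans (cong₂ _+_ (count n (suc j)) (count n j))
      (cong (λ m → + m) (trans (ℕ.+-comm (n Comb.C suc j) (n Comb.C j)) (nCk+nC[k+1]≡[n+1]C[k+1] n j))))

  -- Makes the truncated difference in `multiplicity` a genuine one. Pascal's rule reduces the
  -- successor case to C(n, i) ≤ C(n, i + 2), which is two monotone steps, or an equality by
  -- symmetry when n = 2i + 2.
  C-mono : ∀ n i → suc (2 ℕ.* i) ℕ.≤ n → n Comb.C i ℕ.≤ n Comb.C suc i
  C-mono (suc n) zero    _ = subst (ℕ._≤ suc n Comb.C 1) (sym (nC0≡1 (suc n)))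
    (subst (1 ℕ.≤_) (nCk+nC[k+1]≡[n+1]C[k+1] n 0) (subst (λ z → 1 ℕ.≤ z ℕ.+ n Comb.C 1) (sym (nC0≡1 n)) (ℕ.s≤s ℕ.z≤n)))
  C-mono (suc n) (suc i) le = subst₂ ℕ._≤_ (nCk+nC[k+1]≡[n+1]C[k+1] n i) (nCk+nC[k+1]≡[n+1]C[k+1] n (suc i))
    (subst (ℕ._≤ n Comb.C suc i ℕ.+ n Comb.C suc (suc i)) (ℕ.+-comm (n Comb.C suc i) (n Comb.C i)) (ℕ.+-monoʳ-≤ (n Comb.C suc i) two-steps))
    where
    2+2i≤n : suc (suc (2 ℕ.* i)) ℕ.≤ n
    2+2i≤n = subst (ℕ._≤ n) (cong suc (ℕ.+-suc i (i ℕ.+ 0))) (ℕ.s≤s⁻¹ le)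
    two-steps : n Comb.C i ℕ.≤ n Comb.C suc (suc i)
    two-steps with ℕ.m≤n⇒m<n∨m≡n 2+2i≤n
    ... | inj₁ 3+2i≤n = ℕ.≤-trans (C-mono n i (ℕ.≤-trans (ℕ.n≤1+n _) 2+2i≤n))
                          (C-mono n (suc i) (subst (ℕ._≤ n) (cong (λ z → suc (suc z)) (sym (ℕ.+-suc i (i ℕ.+ 0)))) 3+2i≤n))
    ... | inj₂ refl = ℕ.≤-reflexive (trans (nCk≡nC[n∸k] {i} {n} (ℕ.≤-trans (ℕ.m≤m+n i (i ℕ.+ 0)) (ℕ.m≤n+m (2 ℕ.* i) 2)))
                        (cong (n Comb.C_) (reflect i)))
      where
      reflect : ∀ i → suc (suc (2 ℕ.* i)) ℕ.∸ i ≡ suc (suc i)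
      reflect i = trans (cong (ℕ._∸ i) (cong (λ z → suc (suc (i ℕ.+ z))) (ℕ.+-identityʳ i)))
        (trans (cong (ℕ._∸ i) (cong suc (sym (ℕ.+-suc i i)))) (trans (cong (ℕ._∸ i) (sym (ℕ.+-suc i (suc i)))) (ℕ.m+n∸m≡n i (suc (suc i)))))

-- The spectrum of D U on a layer, by recursion down the lattice.

module LayerSpectrum where

  open Determinant
  open Evaluation
  open BooleanLattice
  open import Data.Fin.Subset using (∣_∣)
  open import Data.Integer.Base using (ℤ; +_; 0ℤ; 1ℤ; _+_; _*_; _-_; -_; _^_; ≢-nonZero)
  open import Data.List.Base using (concatMap; replicate; upTo)

  -- This is det (s I - D U | layer j). The product is spelled out as a sum over the layer above,
  -- the form in which `sylvester` and `schurˡ` deliver it.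
  upDet : ∀ n j → ℤ → ℤ
  upDet n j s = detℤ {length (layer n j)} λ i i′ → scalar s i i′ -
    sum (λ l → cover (lookup (layer n j) i) (lookup (layer n (suc j)) l) * cover (lookup (layer n j) i′) (lookup (layer n (suc j)) l))

  module _ (n j : ℕ) where

    up-entry : ∀ i i′ → let p = lookup (layer n j) i; q = lookup (layer n j) i′ in
      sum (λ l → cover p (lookup (layer n (suc j)) l) * cover q (lookup (layer n (suc j)) l)) ≡ up p q
    up-entry i i′ = trans (sum-lookup (layer n (suc j)) (λ w → cover p w * cover q w))
      (∑-layer n (suc j) λ w ≢ → cong (_* cover q w) (cover-rank p w λ eq → ≢ (trans (sym eq) (cong suc (lookup-layer n j i)))))
      where
      p = lookup (layer n j) i
      q = lookup (layer n j) i′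

    down-entry : ∀ i i′ → let p = lookup (layer n (suc j)) i; q = lookup (layer n (suc j)) i′ in
      sum (λ l → cover (lookup (layer n j) l) p * cover (lookup (layer n j) l) q) ≡ down p q
    down-entry i i′ = trans (sum-lookup (layer n j) (λ v → cover v p * cover v q))
      (∑-layer n j λ v ≢ → cong (_* cover v q) (cover-rank v p λ eq → ≢ (ℕ.suc-injective (trans eq (lookup-layer n (suc j) i)))))
      where
      p = lookup (layer n (suc j)) i
      q = lookup (layer n (suc j)) i′

  -- The commutation relation read on layer j, where ∣ p ∣ = j: its multiple of the identity is
  -- absorbed into the scalar.
  shift-entry : ∀ n j r i i′ → let p = lookup (layer n j) i; q = lookup (layer n j) i′ in
    scalar (r + (+ n - + j - + j)) i i′ - up p q ≡ scalar r i i′ - down p q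
  shift-entry n j r i i′ = begin
    scalar (r + c) i i′ - up p q
      ≡⟨ cong (_- up p q) (scalar-lookup _≟ˢ_ (layer-unique n j) (r + c) i i′) ⟩
    (r + c) * δ p q - up p q
      ≡⟨ add-both (r + c) (δ p q) (up p q) (+ j) ⟩
    (r + c + + j) * δ p q - (up p q + + j * δ p q)
      ≡⟨ cong (λ z → (r + c + + j) * δ p q - z) (subst (λ m → up p q + + m * δ p q ≡ down p q + (+ n - + m) * δ p q)
           (lookup-layer n j i) (up-down p q)) ⟩
    (r + c + + j) * δ p q - (down p q + (+ n - + j) * δ p q)
      ≡⟨ collect r (+ n) (+ j) (δ p q) (down p q) ⟩
    r * δ p q - down p q
      ≡⟨ cong (_- down p q) (scalar-lookup _≟ˢ_ (layer-unique n j) r i i′) ⟨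
    scalar r i i′ - down p q ∎
    where
    open ≡-Reasoning
    p = lookup (layer n j) i
    q = lookup (layer n j) i′
    c = + n - + j - + j
    add-both : ∀ s d u j → s * d - u ≡ (s + j) * d - (u + j * d)
    add-both = solve-∀
    collect : ∀ r n j d e → (r + (n - j - j) + j) * d - (e + (n - j) * d) ≡ r * d - e
    collect = solve-∀

  -- Nothing lies below the empty set, so after the shift by n the operator U D is zero, on a layer
  -- with a single element.
  upDet-zero : ∀ n r → upDet n 0 (r + + n) ≡ r
  upDet-zero n r = begin
    upDet n 0 (r + + n)
      ≡⟨ det-cong (λ i i′ → trans (cong₂ (λ s z → scalar s i i′ - z) (sym (add-zeros r (+ n))) (up-entry n 0 i i′))
           (trans (shift-entry n 0 r i i′) (trans (cong (λ z → scalar r i i′ - z) (no-down i i′)) (ℤ.+-identityʳ _)))) ⟩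
    detℤ {length (layer n 0)} (scalar r)
      ≡⟨ det-scalar (length (layer n 0)) r ⟩
    r ^ length (layer n 0)
      ≡⟨ cong (r ^_) (trans (length-layer n 0) (nC0≡1 n)) ⟩
    r ^ 1
      ≡⟨ ℤ.*-identityʳ r ⟩
    r ∎
    where
    open ≡-Reasoning
    add-zeros : ∀ r n → r + (n - 0ℤ - 0ℤ) ≡ r + n
    add-zeros = solve-∀
    no-down : ∀ i i′ → down (lookup (layer n 0) i) (lookup (layer n 0) i′) ≡ 0ℤ
    no-down i i′ = ∑-zero (subsets n) λ v → cong (_* cover v (lookup (layer n 0) i′))
      (cover-rank v (lookup (layer n 0) i) λ eq → ℕ.1+n≢0 (trans eq (lookup-layer n 0 i)))

  upDet-suc : ∀ n j r →
    r ^ (n Comb.C j) * upDet n (suc j) (r + (+ n - + suc j - + suc j)) ≡ r ^ (n Comb.C suc j) * upDet n j r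
  upDet-suc n j r = begin
    r ^ (n Comb.C j) * upDet n (suc j) (r + (+ n - + suc j - + suc j))
      ≡⟨ cong₂ (λ m z → r ^ m * z) (sym (length-layer n j)) (det-cong λ i i′ → trans
           (cong (λ z → scalar (r + (+ n - + suc j - + suc j)) i i′ - z) (up-entry n (suc j) i i′))
           (trans (shift-entry n (suc j) r i i′) (cong (λ z → scalar r i i′ - z) (sym (down-entry n j i i′))))) ⟩
    r ^ length (layer n j) * detℤ (λ i i′ → scalar r i i′ - sum (λ l → D i l * U l i′))
      ≡⟨ sylvester r D U ⟩
    r ^ length (layer n (suc j)) * upDet n j r
      ≡⟨ cong (λ m → r ^ m * upDet n j r) (length-layer n (suc j)) ⟩
    r ^ (n Comb.C suc j) * upDet n j r ∎
    where
    open ≡-Reasoning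
    D : Mat (length (layer n (suc j))) (length (layer n j))
    D i l = cover (lookup (layer n j) l) (lookup (layer n (suc j)) i)
    U : Mat (length (layer n j)) (length (layer n (suc j)))
    U l i = D i l

  -- The last factor is split off, because each step up the lattice contributes a new highest index.
  ∏< : ℕ → (ℕ → ℤ) → ℤ
  ∏< zero    f = 1ℤ
  ∏< (suc m) f = ∏< m f * f m

  ∏<-cong : ∀ m {f g : ℕ → ℤ} → (∀ i → f i ≡ g i) → ∏< m f ≡ ∏< m g
  ∏<-cong zero    eq = refl
  ∏<-cong (suc m) eq = cong₂ _*_ (∏<-cong m eq) (eq m)

  ∏<-* : ∀ m (f g : ℕ → ℤ) → ∏< m f * ∏< m g ≡ ∏< m (λ i → f i * g i)
  ∏<-* zero    f g = refl
  ∏<-* (suc m) f g = trans (interchange (∏< m f) (f m) (∏< m g) (g m)) (cong (_* (f m * g m)) (∏<-* m f g))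
    where
    interchange : ∀ a b c d → a * b * (c * d) ≡ a * c * (b * d)
    interchange = solve-∀

  ∏<-head : ∀ m (f : ℕ → ℤ) → ∏< (suc m) f ≡ f 0 * ∏< m (f ∘ suc)
  ∏<-head zero    f = ℤ.*-comm 1ℤ (f 0)
  ∏<-head (suc m) f = trans (cong (_* f (suc m)) (∏<-head m f)) (ℤ.*-assoc (f 0) (∏< m (f ∘ suc)) (f (suc m)))

  ∏-concatMap-upTo : ∀ x m (e : ℕ → ℕ) (r : ℕ → ℤ) →
    rootProduct x (concatMap (λ i → replicate (e i) (r i)) (upTo m)) ≡ ∏< m (λ i → (x - r i) ^ e i)
  ∏-concatMap-upTo x zero    e r = refl
  ∏-concatMap-upTo x (suc m) e r = begin
    rootProduct x (concatMap g (upTo (suc m)))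
      ≡⟨ cong (λ is → rootProduct x (concatMap g is)) (List.upTo-∷ʳ m) ⟨
    rootProduct x (concatMap g (upTo m List.++ m ∷ []))
      ≡⟨ cong (rootProduct x) (List.concatMap-++ g (upTo m) (m ∷ [])) ⟩
    rootProduct x (concatMap g (upTo m) List.++ (g m List.++ []))
      ≡⟨ ∏-++ x (concatMap g (upTo m)) (g m List.++ []) ⟩
    rootProduct x (concatMap g (upTo m)) * rootProduct x (g m List.++ [])
      ≡⟨ cong₂ _*_ (∏-concatMap-upTo x m e r) (trans (cong (rootProduct x) (List.++-identityʳ (g m))) (∏-replicate x (e m) (r m))) ⟩
    ∏< (suc m) (λ i → (x - r i) ^ e i) ∎
    where
    open ≡-Reasoning
    g : ℕ → List ℤ
    g i = replicate (e i) (r i)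

  ^-distribʳ-* : ∀ x y m → (x * y) ^ m ≡ x ^ m * y ^ m
  ^-distribʳ-* x y zero    = refl
  ^-distribʳ-* x y (suc m) = trans (cong (x * y *_) (^-distribʳ-* x y m)) (interchange x y (x ^ m) (y ^ m))
    where
    interchange : ∀ a b c d → a * b * (c * d) ≡ a * c * (b * d)
    interchange = solve-∀

  cancel-^ : ∀ {t} m {x y} → t ≢ 0ℤ → t ^ m * x ≡ t ^ m * y → x ≡ y
  cancel-^ {t} m {x} {y} t≢0 eq = ℤ.*-cancelˡ-≡ (t ^ m) x y {{≢-nonZero (t≢0 ∘ ℤ.i^n≡0⇒i≡0 t m)}} eq

  square-difference≢0 : ∀ {c Y} → c ℕ.< Y → + Y * + Y - + c * + c ≢ 0ℤ
  square-difference≢0 {c} {Y} c<Y eq = ℕ.<-irrefl (sym (ℤ.+-injective (begin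
    + (Y ℕ.* Y)     ≡⟨ ℤ.pos-* Y Y ⟩
    + Y * + Y       ≡⟨ ℤ.i-j≡0⇒i≡j (+ Y * + Y) (+ c * + c) eq ⟩
    + c * + c       ≡⟨ ℤ.pos-* c c ⟨
    + (c ℕ.* c)     ∎))) (ℕ.*-mono-< c<Y c<Y)
    where open ≡-Reasoning

  -- The literal form of the statement. By computation it is C(n, 0) at 0, where the lower index is
  -- -1, and C(n, j + 1) ∸ C(n, j) at `suc j`.
  multiplicity : ℕ → ℕ → ℕ
  multiplicity n i = binom n (+ i) ℕ.∸ binom n (+ i - + 1)

  -- With n = 2h + 1, the shift r = s - (n - 2j) of the recursion turns
  -- s = y² - d² into y² - (d + 1)², where d = h - j.
  upDet-product : ∀ {h Y} → suc h ℕ.< Y → ∀ j d → j ℕ.+ d ≡ h →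
    upDet (suc (2 ℕ.* h)) j (+ Y * + Y - + d * + d) ≡
    ∏< (suc j) (λ i → (+ Y * + Y - (+ suc h - + i) * (+ suc h - + i)) ^ multiplicity (suc (2 ℕ.* h)) i)
  upDet-product {Y = Y} h<Y zero d refl = begin
    upDet N 0 (y * y - + d * + d)
      ≡⟨ cong (upDet N 0) (trans (shift y (+ d)) (cong (λ z → r + z) (sym n≡))) ⟩
    upDet N 0 (r + + N)
      ≡⟨ upDet-zero N r ⟩
    r
      ≡⟨ trans (power-one r) (cong (λ m → 1ℤ * r ^ m) (sym (nC0≡1 N))) ⟩
    1ℤ * r ^ (N Comb.C 0) ∎
    where
    open ≡-Reasoning
    N = suc (2 ℕ.* d)
    y = + Y
    r = y * y - (+ suc d - + 0) * (+ suc d - + 0)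
    n≡ : + N ≡ 1ℤ + (+ 2) * + d
    n≡ = cong (λ z → 1ℤ + z) (ℤ.pos-* 2 d)
    shift : ∀ y d → y * y - d * d ≡ y * y - (1ℤ + d - 0ℤ) * (1ℤ + d - 0ℤ) + (1ℤ + (+ 2) * d)
    shift = solve-∀
    power-one : ∀ r → r ≡ 1ℤ * (r * 1ℤ)
    power-one = solve-∀
  -- `upDet-suc` puts r to the power C(N, j) on the left and C(N, j + 1) on the right; cancelling
  -- the former leaves the multiplicity of the new index j + 1. Cancelling is legitimate since d + 1
  -- ≤ h + 1 < Y makes r non-zero.
  upDet-product {Y = Y} h<Y (suc j) d refl = cancel-^ (N Comb.C j) {y = ∏< (suc j) f * f (suc j)} r≢0 (begin
    r ^ (N Comb.C j) * upDet N (suc j) (y * y - + d * + d)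
      ≡⟨ cong (λ s → r ^ (N Comb.C j) * upDet N (suc j) s) (trans (shift y (+ d) (+ j)) (cong (λ z → r + (z - + suc j - + suc j)) (sym n≡))) ⟩
    r ^ (N Comb.C j) * upDet N (suc j) (r + (+ N - + suc j - + suc j))
      ≡⟨ upDet-suc N j r ⟩
    r ^ (N Comb.C suc j) * upDet N j r
      ≡⟨ cong₂ (λ m z → r ^ m * z) (sym (ℕ.m+[n∸m]≡n (C-mono N j 1+2j≤N))) (upDet-product h<Y j (suc d) (ℕ.+-suc j d)) ⟩
    r ^ (N Comb.C j ℕ.+ (N Comb.C suc j ℕ.∸ N Comb.C j)) * ∏< (suc j) f
      ≡⟨ cong (_* ∏< (suc j) f) (ℤ.^-distribˡ-+-* r (N Comb.C j) (N Comb.C suc j ℕ.∸ N Comb.C j)) ⟩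
    r ^ (N Comb.C j) * r ^ (N Comb.C suc j ℕ.∸ N Comb.C j) * ∏< (suc j) f
      ≡⟨ swap (r ^ (N Comb.C j)) (r ^ (N Comb.C suc j ℕ.∸ N Comb.C j)) (∏< (suc j) f) ⟩
    r ^ (N Comb.C j) * (∏< (suc j) f * r ^ (N Comb.C suc j ℕ.∸ N Comb.C j))
      ≡⟨ cong (λ z → r ^ (N Comb.C j) * (∏< (suc j) f * z ^ (N Comb.C suc j ℕ.∸ N Comb.C j))) (eigenvalue y (+ j) (+ d)) ⟩
    r ^ (N Comb.C j) * (∏< (suc j) f * f (suc j)) ∎)
    where
    open ≡-Reasoning
    h = suc j ℕ.+ d
    N = suc (2 ℕ.* h)
    y = + Y
    r = y * y - + suc d * + suc d
    f : ℕ → ℤ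
    f i = (y * y - (+ suc h - + i) * (+ suc h - + i)) ^ multiplicity N i
    r≢0 : r ≢ 0ℤ
    r≢0 = square-difference≢0 (ℕ.≤-<-trans (ℕ.s≤s (ℕ.m≤n+m d (suc j))) h<Y)
    n≡ : + N ≡ 1ℤ + (+ 2) * (1ℤ + + j + + d)
    n≡ = cong (λ z → 1ℤ + z) (ℤ.pos-* 2 h)
    1+2j≤N : suc (2 ℕ.* j) ℕ.≤ N
    1+2j≤N = ℕ.s≤s (ℕ.*-monoʳ-≤ 2 (ℕ.≤-trans (ℕ.n≤1+n j) (ℕ.m≤m+n (suc j) d)))
    shift : ∀ y d j → y * y - d * d ≡ y * y - (1ℤ + d) * (1ℤ + d) + (1ℤ + (+ 2) * (1ℤ + j + d) - (1ℤ + j) - (1ℤ + j))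
    shift = solve-∀
    swap : ∀ a b c → a * b * c ≡ a * (c * b)
    swap = solve-∀
    eigenvalue : ∀ y j d → y * y - (1ℤ + d) * (1ℤ + d)
               ≡ y * y - (1ℤ + (1ℤ + j + d) - (1ℤ + j)) * (1ℤ + (1ℤ + j + d) - (1ℤ + j))
    eigenvalue = solve-∀

-- From the line graph to the cover matrix of two layers.

module LineGraph where

  open Determinant
  open Evaluation
  open BooleanLattice
  open LayerSpectrum
  open import Data.Fin.Subset using (∣_∣)
  open import Data.Integer.Base using (ℤ; +_; 0ℤ; 1ℤ; _+_; _*_; _-_; -_; _^_)

  private variable
    n o : ℕ

  -- `edges` lists every edge with the earlier vertex first; since `subsets` is
  -- ascending, that vertex is the smaller set.
  Ascending : List (Subset n) → Set
  Ascending = AllPairs (λ p q → cover q p ≡ 0ℤ)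

  subsets-ascending : ∀ n → Ascending (subsets n)
  subsets-ascending zero    = [] ∷ []
  subsets-ascending (suc n) = AllPairs.++⁺
    (AllPairs.map⁺ (subsets-ascending n)) (AllPairs.map⁺ (subsets-ascending n))
    (All.map⁺ (All.universal (λ _ → All.map⁺ (All.universal (λ _ → refl) (subsets n))) (subsets n)))

  -- Edges between the layers j = k - 1 and k, for arbitrary n, and their incidence matrix.

  module Layers (n j : ℕ) where

    Γ : Graph
    Γ = BLlayers n (suc j)

    open Graph (lineGraph Γ) using () renaming (_≟_ to _≟ᵉ_)

    E : List (Subset n × Subset n)
    E = edges Γ

    InLayers : Subset n → Set
    InLayers p = suc ∣ p ∣ ≡ suc j ⊎ ∣ p ∣ ≡ suc j

    inLayers? : ∀ p → Dec (InLayers p)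
    inLayers? p = (suc ∣ p ∣ ℕ.≟ suc j) ⊎-dec (∣ p ∣ ℕ.≟ suc j)

    -- For q after v in an ascending list `cover q v` is 0, so adjacency is `cover v q`. The pairs
    -- (v , v) and (q , v), which are not listed as edges, have weight 0 and can be added to reach
    -- the full double sum.
    ∑-edgesAmong : ∀ {vs} → Ascending vs → (g : Subset n × Subset n → ℤ) →
      ∑ (edgesAmong Γ vs) g ≡ ∑ vs (λ p → ∑ vs (λ q → cover p q * g (p , q)))
    ∑-edgesAmong []                    g = refl
    ∑-edgesAmong {v ∷ vs} (v↑ ∷ vs↑) g = begin
      ∑ (List.map (v ,_) (filter (Graph.adj? Γ v) vs) List.++ edgesAmong Γ vs) g
        ≡⟨ ∑-++ (List.map (v ,_) (filter (Graph.adj? Γ v) vs)) (edgesAmong Γ vs) ⟩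
      ∑ (List.map (v ,_) (filter (Graph.adj? Γ v) vs)) g + ∑ (edgesAmong Γ vs) g
        ≡⟨ cong₂ _+_ (trans (∑-map (v ,_) (filter (Graph.adj? Γ v) vs)) (∑-filter (Graph.adj? Γ v) vs)) (∑-edgesAmong vs↑ g) ⟩
      ∑ vs (λ q → 𝟙 (∣ v △ q ∣ ℕ.≟ 1) * g (v , q)) + R
        ≡⟨ cong (_+ R) (from-v vs v↑) ⟩
      ∑ vs (λ q → cover v q * g (v , q)) + R
        ≡⟨ cong₂ _+_ (trans (sym (ℤ.+-identityˡ (∑ vs (λ q → cover v q * g (v , q))))) (cong (λ z → z * g (v , v) + ∑ vs (λ q → cover v q * g (v , q))) (sym (cover-irrefl v))))
             (sym (to-v vs v↑)) ⟩
      cover v v * g (v , v) + ∑ vs (λ q → cover v q * g (v , q))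
        + ∑ vs (λ p → cover p v * g (p , v) + ∑ vs (λ q → cover p q * g (p , q))) ∎
      where
      open ≡-Reasoning
      R = ∑ vs (λ p → ∑ vs (λ q → cover p q * g (p , q)))
      from-v : ∀ ws → All (λ q → cover q v ≡ 0ℤ) ws →
        ∑ ws (λ q → 𝟙 (∣ v △ q ∣ ℕ.≟ 1) * g (v , q)) ≡ ∑ ws (λ q → cover v q * g (v , q))
      from-v []       []         = refl
      from-v (q ∷ ws) (q↓ ∷ ws↓) = cong₂ _+_
        (cong (_* g (v , q)) (trans (adjacent-cover v q) (trans (cong (λ z → cover v q + z) q↓) (ℤ.+-identityʳ (cover v q)))))
        (from-v ws ws↓)
      to-v : ∀ ws {f : Subset n → ℤ} → All (λ q → cover q v ≡ 0ℤ) ws →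
        ∑ ws (λ p → cover p v * g (p , v) + f p) ≡ ∑ ws f
      to-v []       []         = refl
      to-v (p ∷ ws) {f} (p↓ ∷ ws↓) = cong₂ _+_ (trans (cong (λ z → z * g (p , v) + f p) p↓) (ℤ.+-identityˡ (f p))) (to-v ws ws↓)

    ∈-edgesAmong : ∀ {vs} → Ascending vs → ∀ {p q} → (p , q) ∈ edgesAmong Γ vs → p ∈ vs × q ∈ vs × cover p q ≡ 1ℤ
    ∈-edgesAmong {v ∷ vs} (v↑ ∷ vs↑) {p} {q} pq∈ with ∈-++⁻ (List.map (v ,_) (filter (Graph.adj? Γ v) vs)) pq∈
    ... | inj₂ pq∈′ = let p∈ , q∈ , c = ∈-edgesAmong vs↑ pq∈′ in there p∈ , there q∈ , c
    ... | inj₁ pq∈′ with ∈-map⁻ (v ,_) pq∈′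
    ...   | _ , q∈′ , refl with ∈-filter⁻ (Graph.adj? Γ v) {xs = vs} q∈′
    ...     | q∈ , adj = here refl , there q∈ , (begin
      cover p q              ≡⟨ ℤ.+-identityʳ _ ⟨
      cover p q + 0ℤ         ≡⟨ cong (λ z → cover p q + z) (All.lookup v↑ q∈) ⟨
      cover p q + cover q p  ≡⟨ adjacent-cover p q ⟨
      𝟙 (∣ p △ q ∣ ℕ.≟ 1)    ≡⟨ 𝟙-yes (∣ p △ q ∣ ℕ.≟ 1) adj ⟩
      1ℤ                     ∎)
      where open ≡-Reasoning

    vertices-ascending : Ascending (Graph.vertices Γ)
    vertices-ascending = AllPairs.filter⁺ inLayers? (subsets-ascending n)

    edge-ranks : ∀ {p q} → (p , q) ∈ E → ∣ p ∣ ≡ j × ∣ q ∣ ≡ suc j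
    edge-ranks {p} {q} e∈ = let p∈ , q∈ , c = ∈-edgesAmong vertices-ascending e∈ in
      ranks (proj₂ (∈-filter⁻ inLayers? {xs = subsets n} p∈)) (proj₂ (∈-filter⁻ inLayers? {xs = subsets n} q∈)) (covering c)
      where
      covering : cover p q ≡ 1ℤ → suc ∣ p ∣ ≡ ∣ q ∣
      covering c with suc ∣ p ∣ ℕ.≟ ∣ q ∣
      ... | yes eq = eq
      ... | no ≢ with () ← trans (sym c) (cover-rank p q ≢)
      ranks : InLayers p → InLayers q → suc ∣ p ∣ ≡ ∣ q ∣ → ∣ p ∣ ≡ j × ∣ q ∣ ≡ suc j
      ranks (inj₁ p₁) _         eq = ℕ.suc-injective p₁ , trans (sym eq) p₁
      ranks (inj₂ p₂) (inj₁ q₁) eq = contradiction (trans (trans (cong suc (sym p₂)) eq) (ℕ.suc-injective q₁)) λ eq′ → ℕ.<-irrefl (sym eq′) (ℕ.m<n⇒m<1+n (ℕ.n<1+n j))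
      ranks (inj₂ p₂) (inj₂ q₂) eq = contradiction (trans (trans (cong suc (sym p₂)) eq) q₂) ℕ.1+n≢n

    -- `cover` raises the rank by exactly one, so of the four ways to place p and q in the two
    -- layers only p below q survives.
    ∑-edges : (g : Subset n × Subset n → ℤ) →
      ∑ E g ≡ ∑ (layer n j) (λ p → ∑ (layer n (suc j)) (λ q → cover p q * g (p , q)))
    ∑-edges g = begin
      ∑ E g
        ≡⟨ ∑-edgesAmong vertices-ascending g ⟩
      ∑ (Graph.vertices Γ) (λ p → ∑ (Graph.vertices Γ) (λ q → cover p q * g (p , q)))
        ≡⟨ ∑-filter inLayers? (subsets n) ⟩
      ∑ (subsets n) (λ p → 𝟙 (inLayers? p) * ∑ (Graph.vertices Γ) (λ q → cover p q * g (p , q)))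
        ≡⟨ ∑-cong (subsets n) lower ⟩
      ∑ (subsets n) (λ p → 𝟙 (∣ p ∣ ℕ.≟ j) * ∑ (layer n (suc j)) (λ q → cover p q * g (p , q)))
        ≡⟨ ∑-filter (λ p → ∣ p ∣ ℕ.≟ j) (subsets n) ⟨
      ∑ (layer n j) (λ p → ∑ (layer n (suc j)) (λ q → cover p q * g (p , q))) ∎
      where
      open ≡-Reasoning
      no-cover : ∀ p q → suc ∣ p ∣ ≢ ∣ q ∣ → (x : ℤ) → x * (cover p q * g (p , q)) ≡ 0ℤ
      no-cover p q ≢ x = trans (cong (λ z → x * (z * g (p , q))) (cover-rank p q ≢)) (ℤ.*-zeroʳ x)
      above : ∀ p q → ∣ p ∣ ≡ j → 𝟙 (inLayers? q) * (cover p q * g (p , q)) ≡ 𝟙 (∣ q ∣ ℕ.≟ suc j) * (cover p q * g (p , q))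
      above p q p≡j = go (∣ q ∣ ℕ.≟ suc j)
        where
        go : (q? : Dec (∣ q ∣ ≡ suc j)) → 𝟙 (inLayers? q) * (cover p q * g (p , q)) ≡ 𝟙 q? * (cover p q * g (p , q))
        go (yes q≡) = cong (_* (cover p q * g (p , q))) (𝟙-yes (inLayers? q) (inj₂ q≡))
        go (no q≢)  = no-cover p q (λ eq → q≢ (trans (sym eq) (cong suc p≡j))) (𝟙 (inLayers? q))
      top : ∀ p q → ∣ p ∣ ≡ suc j → (q? : Dec (InLayers q)) → 𝟙 q? * (cover p q * g (p , q)) ≡ 0ℤ
      top p q p≡1+j (no _)           = refl
      top p q p≡1+j (yes (inj₁ q≡j)) = no-cover p q (λ eq → ℕ.<-irrefl (ℕ.suc-injective (trans (sym q≡j) (cong suc (trans (sym eq) (cong suc p≡1+j))))) (ℕ.m<n⇒m<1+n (ℕ.n<1+n j))) 1ℤ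
      top p q p≡1+j (yes (inj₂ q≡1+j)) = no-cover p q (λ eq → ℕ.1+n≢n (trans (cong suc (sym p≡1+j)) (trans eq q≡1+j))) 1ℤ
      lower : ∀ p → 𝟙 (inLayers? p) * ∑ (Graph.vertices Γ) (λ q → cover p q * g (p , q))
                  ≡ 𝟙 (∣ p ∣ ℕ.≟ j) * ∑ (layer n (suc j)) (λ q → cover p q * g (p , q))
      lower p = go (∣ p ∣ ℕ.≟ j) (inLayers? p)
        where
        go : (p? : Dec (∣ p ∣ ≡ j)) (p?′ : Dec (InLayers p)) → 𝟙 p?′ * ∑ (Graph.vertices Γ) (λ q → cover p q * g (p , q))
           ≡ 𝟙 p? * ∑ (layer n (suc j)) (λ q → cover p q * g (p , q))
        go (yes p≡j) p?′ = cong₂ _*_ (𝟙-yes p?′ (inj₁ (cong suc p≡j)))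
          (trans (∑-filter inLayers? (subsets n)) (trans (∑-cong (subsets n) (λ q → above p q p≡j))
            (sym (∑-filter (λ q → ∣ q ∣ ℕ.≟ suc j) (subsets n)))))
        go (no p≢j) (no _)             = refl
        go (no p≢j) (yes (inj₁ p≡j))   = contradiction (ℕ.suc-injective p≡j) p≢j
        go (no p≢j) (yes (inj₂ p≡1+j)) = trans (ℤ.*-identityˡ _)
          (trans (∑-filter inLayers? (subsets n)) (∑-zero (subsets n) λ q → top p q p≡1+j (inLayers? q)))

    ∑-layer-δ : ∀ {i} (p : Subset n) → ∣ p ∣ ≡ i → (f : Subset n → ℤ) → ∑ (layer n i) (λ q → δ p q * f q) ≡ f p
    ∑-layer-δ {i} p p∈ f = ∑-𝟙≟ _≟ˢ_ (layer-unique n i) (∈-layer p p∈) f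

    ∑-layer-δδ : ∀ {i} (p q : Subset n) → ∣ p ∣ ≡ i → ∑ (layer n i) (λ v → δ v p * δ v q) ≡ δ p q
    ∑-layer-δδ {i} p q p∈ = trans (∑-cong (layer n i) λ v → cong (_* δ v q) (δ-sym v p)) (∑-layer-δ p p∈ (λ v → δ v q))

    degree-up : ∀ p → ∣ p ∣ ≡ j → ∑ (layer n (suc j)) (cover p) ≡ + n - + j
    degree-up p refl = trans (∑-layer n (suc j) λ q ≢ → cover-rank p q (≢ ∘ sym)) (up-degree p)

    degree-down : ∀ q → ∣ q ∣ ≡ suc j → ∑ (layer n j) (λ p → cover p q) ≡ + suc j
    degree-down q eq = trans (∑-layer n j λ p ≢ → cover-rank p q λ eq′ → ≢ (ℕ.suc-injective (trans eq′ eq)))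
      (trans (down-degree q) (cong (λ m → + m) eq))

    -- This and the next two lemmas compute the Gram matrix of the incidence columns: vertex degrees
    -- in the two diagonal blocks, the cover matrix in the others.
    ∑-lower-lower : ∀ p p′ → ∣ p ∣ ≡ j → ∑ E (λ e → δ p (proj₁ e) * δ p′ (proj₁ e)) ≡ (+ n - + j) * δ p p′
    ∑-lower-lower p p′ p∈ = begin
      ∑ E (λ e → δ p (proj₁ e) * δ p′ (proj₁ e))
        ≡⟨ ∑-edges _ ⟩
      ∑ (layer n j) (λ u → ∑ (layer n (suc j)) (λ w → cover u w * (δ p u * δ p′ u)))
        ≡⟨ ∑-cong (layer n j) (λ u → trans (∑-cong (layer n (suc j)) λ w → move (cover u w) (δ p u) (δ p′ u))
             (sym (*-distribˡ-∑ (δ p u) (layer n (suc j))))) ⟩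
      ∑ (layer n j) (λ u → δ p u * ∑ (layer n (suc j)) (λ w → δ p′ u * cover u w))
        ≡⟨ ∑-layer-δ p p∈ (λ u → ∑ (layer n (suc j)) (λ w → δ p′ u * cover u w)) ⟩
      ∑ (layer n (suc j)) (λ w → δ p′ p * cover p w)
        ≡⟨ *-distribˡ-∑ (δ p′ p) (layer n (suc j)) ⟨
      δ p′ p * ∑ (layer n (suc j)) (cover p)
        ≡⟨ cong₂ _*_ (δ-sym p′ p) (degree-up p p∈) ⟩
      δ p p′ * (+ n - + j)
        ≡⟨ ℤ.*-comm (δ p p′) (+ n - + j) ⟩
      (+ n - + j) * δ p p′ ∎
      where
      open ≡-Reasoning
      move : ∀ c d e → c * (d * e) ≡ d * (e * c)
      move = solve-∀

    ∑-lower-upper : ∀ p q → ∣ p ∣ ≡ j → ∣ q ∣ ≡ suc j → ∑ E (λ e → δ p (proj₁ e) * δ q (proj₂ e)) ≡ cover p q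
    ∑-lower-upper p q p∈ q∈ = begin
      ∑ E (λ e → δ p (proj₁ e) * δ q (proj₂ e))
        ≡⟨ ∑-edges _ ⟩
      ∑ (layer n j) (λ u → ∑ (layer n (suc j)) (λ w → cover u w * (δ p u * δ q w)))
        ≡⟨ ∑-cong (layer n j) (λ u → trans (∑-cong (layer n (suc j)) λ w → move (cover u w) (δ p u) (δ q w))
             (sym (*-distribˡ-∑ (δ p u) (layer n (suc j))))) ⟩
      ∑ (layer n j) (λ u → δ p u * ∑ (layer n (suc j)) (λ w → δ q w * cover u w))
        ≡⟨ ∑-layer-δ p p∈ (λ u → ∑ (layer n (suc j)) (λ w → δ q w * cover u w)) ⟩
      ∑ (layer n (suc j)) (λ w → δ q w * cover p w)
        ≡⟨ ∑-layer-δ q q∈ (cover p) ⟩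
      cover p q ∎
      where
      open ≡-Reasoning
      move : ∀ c d e → c * (d * e) ≡ d * (e * c)
      move = solve-∀

    ∑-upper-upper : ∀ q q′ → ∣ q ∣ ≡ suc j → ∑ E (λ e → δ q (proj₂ e) * δ q′ (proj₂ e)) ≡ + suc j * δ q q′
    ∑-upper-upper q q′ q∈ = begin
      ∑ E (λ e → δ q (proj₂ e) * δ q′ (proj₂ e))
        ≡⟨ ∑-edges _ ⟩
      ∑ (layer n j) (λ u → ∑ (layer n (suc j)) (λ w → cover u w * (δ q w * δ q′ w)))
        ≡⟨ ∑-cong (layer n j) (λ u → trans (∑-cong (layer n (suc j)) λ w → move (cover u w) (δ q w) (δ q′ w))
             (∑-layer-δ q q∈ (λ w → δ q′ w * cover u w))) ⟩
      ∑ (layer n j) (λ u → δ q′ q * cover u q)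
        ≡⟨ *-distribˡ-∑ (δ q′ q) (layer n j) ⟨
      δ q′ q * ∑ (layer n j) (λ u → cover u q)
        ≡⟨ cong₂ _*_ (δ-sym q′ q) (degree-down q q∈) ⟩
      δ q q′ * + suc j
        ≡⟨ ℤ.*-comm (δ q q′) (+ suc j) ⟩
      + suc j * δ q q′ ∎
      where
      open ≡-Reasoning
      move : ∀ c d e → c * (d * e) ≡ d * (e * c)
      move = solve-∀

    -- Double counting by upper ends: each edge has one, and each upper vertex lies on j + 1 edges.
    -- That degree is a diagonal entry of `∑-upper-upper`, which is why δ gets squared on the way.
    length-edges : + length E ≡ + suc j * + (n Comb.C suc j)
    length-edges = begin
      + length E
        ≡⟨ ∑-length E ⟨
      ∑ E (λ _ → 1ℤ)
        ≡⟨ ∑-cong-∈ E (λ e e∈ → ∑-layer-δ (proj₂ e) (proj₂ (edge-ranks e∈)) (λ _ → 1ℤ)) ⟨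
      ∑ E (λ e → ∑ (layer n (suc j)) (λ q → δ (proj₂ e) q * 1ℤ))
        ≡⟨ ∑-comm-∑ E (layer n (suc j)) ⟩
      ∑ (layer n (suc j)) (λ q → ∑ E (λ e → δ (proj₂ e) q * 1ℤ))
        ≡⟨ ∑-cong-∈ (layer n (suc j)) (λ q q∈ → trans
             (∑-cong E λ e → trans (ℤ.*-identityʳ (δ (proj₂ e) q)) (trans (δ-sym (proj₂ e) q) (sym (δ-idem q (proj₂ e)))))
             (trans (∑-upper-upper q q (proj₂ (∈-filter⁻ (λ p → ∣ p ∣ ℕ.≟ suc j) {xs = subsets n} q∈)))
               (cong (+ suc j *_) (δ-refl q)))) ⟩
      ∑ (layer n (suc j)) (λ _ → + suc j * 1ℤ)
        ≡⟨ *-distribˡ-∑ (+ suc j) (layer n (suc j)) ⟨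
      + suc j * ∑ (layer n (suc j)) (λ _ → 1ℤ)
        ≡⟨ cong (+ suc j *_) (trans (∑-length (layer n (suc j))) (cong (λ m → + m) (length-layer n (suc j)))) ⟩
      + suc j * + (n Comb.C suc j) ∎
      where
      open ≡-Reasoning
      δ-idem : ∀ p q → δ p q * δ p q ≡ δ p q
      δ-idem p q with does (p ≟ˢ q)
      ... | true  = refl
      ... | false = refl

    -- Distinct edges share at most one of the two kinds of ends, while an edge shares both with
    -- itself, whence the 2. A lower end never equals an upper end, because their ranks differ.
    adjacency-entry : ∀ {e f} → e ∈ E → f ∈ E →
      𝟙 (Graph.adj? (lineGraph Γ) e f) + (+ 2) * 𝟙 (e ≟ᵉ f) ≡ δ (proj₁ e) (proj₁ f) + δ (proj₂ e) (proj₂ f)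
    adjacency-entry {e@(p , q)} {f@(p′ , q′)} e∈ f∈ = go (p ≟ˢ p′) (q ≟ˢ q′)
      where
      adjacent : {x : ℤ} → Graph.Adj (lineGraph Γ) e f → x ≡ 1ℤ →
        𝟙 (Graph.adj? (lineGraph Γ) e f) + (+ 2) * 𝟙 (e ≟ᵉ f) ≡ x
      adjacent adj@(e≢f , _) x≡1 = trans (cong₂ (λ y z → y + (+ 2) * z)
        (𝟙-yes (Graph.adj? (lineGraph Γ) e f) adj) (𝟙-no (e ≟ᵉ f) e≢f)) (sym x≡1)
      ranks-differ : ∀ {u w : Subset n} → ∣ u ∣ ≡ j → ∣ w ∣ ≡ suc j → u ≢ w
      ranks-differ u≡ w≡ refl = ℕ.1+n≢n (trans (sym w≡) u≡)
      disjoint : p ≢ p′ → q ≢ q′ → ¬ ShareEndpoint Γ e f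
      disjoint p≢p′ q≢q′ (inj₁ (inj₁ p≡p′)) = p≢p′ p≡p′
      disjoint p≢p′ q≢q′ (inj₁ (inj₂ p≡q′)) = ranks-differ (proj₁ (edge-ranks e∈)) (proj₂ (edge-ranks f∈)) p≡q′
      disjoint p≢p′ q≢q′ (inj₂ (inj₁ q≡p′)) = ranks-differ (proj₁ (edge-ranks f∈)) (proj₂ (edge-ranks e∈)) (sym q≡p′)
      disjoint p≢p′ q≢q′ (inj₂ (inj₂ q≡q′)) = q≢q′ q≡q′
      go : (p? : Dec (p ≡ p′)) (q? : Dec (q ≡ q′)) →
        𝟙 (Graph.adj? (lineGraph Γ) e f) + (+ 2) * 𝟙 (e ≟ᵉ f) ≡ 𝟙 p? + 𝟙 q?
      go (yes p≡p′) (yes q≡q′) = cong₂ (λ y z → y + (+ 2) * z)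
        (𝟙-no (Graph.adj? (lineGraph Γ) e f) λ (e≢f , _) → e≢f (cong₂ _,_ p≡p′ q≡q′)) (𝟙-yes (e ≟ᵉ f) (cong₂ _,_ p≡p′ q≡q′))
      go (yes p≡p′) (no q≢q′)  = adjacent ((q≢q′ ∘ cong proj₂) , inj₁ (inj₁ p≡p′)) refl
      go (no p≢p′)  (yes q≡q′) = adjacent ((p≢p′ ∘ cong proj₁) , inj₂ (inj₂ q≡q′)) refl
      go (no p≢p′)  (no q≢q′)  = cong₂ (λ y z → y + (+ 2) * z)
        (𝟙-no (Graph.adj? (lineGraph Γ) e f) (disjoint p≢p′ q≢q′ ∘ proj₂)) (𝟙-no (e ≟ᵉ f) (p≢p′ ∘ cong proj₁))

    a b m : ℕ
    a = length (layer n j)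
    b = length (layer n (suc j))
    m = length E

    lowerEnd : Mat m a
    lowerEnd e l = δ (lookup (layer n j) l) (proj₁ (lookup E e))

    upperEnd : Mat m b
    upperEnd e l = δ (lookup (layer n (suc j)) l) (proj₂ (lookup E e))

    incidence : Mat m (a ℕ.+ b)
    incidence = beside lowerEnd upperEnd

    incidenceᵀ : Mat (a ℕ.+ b) m
    incidenceᵀ = (λ l e → lowerEnd e l) Vector.++ (λ l e → upperEnd e l)

    coverMat : Mat a b
    coverMat l l′ = cover (lookup (layer n j) l) (lookup (layer n (suc j)) l′)

    edge-gram : ∀ i i′ → sum (λ l → incidence i l * incidenceᵀ l i′) ≡
      δ (proj₁ (lookup E i)) (proj₁ (lookup E i′)) + δ (proj₂ (lookup E i)) (proj₂ (lookup E i′))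
    edge-gram i i′ = begin
      sum (λ l → incidence i l * incidenceᵀ l i′)
        ≡⟨ sum-++ {a} {b} (λ l → incidence i l * incidenceᵀ l i′) ⟩
      sum (λ l → incidence i (l ↑ˡ b) * incidenceᵀ (l ↑ˡ b) i′) + sum (λ l → incidence i (a ↑ʳ l) * incidenceᵀ (a ↑ʳ l) i′)
        ≡⟨ cong₂ _+_
             (sum-cong-≗ λ l → cong₂ _*_ (++-↑ˡ (lowerEnd i) (upperEnd i) l) (cong-app (++-↑ˡ (λ l e → lowerEnd e l) (λ l e → upperEnd e l) l) i′))
             (sum-cong-≗ λ l → cong₂ _*_ (++-↑ʳ (lowerEnd i) (upperEnd i) l) (cong-app (++-↑ʳ (λ l e → lowerEnd e l) (λ l e → upperEnd e l) l) i′)) ⟩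
      sum (λ l → lowerEnd i l * lowerEnd i′ l) + sum (λ l → upperEnd i l * upperEnd i′ l)
        ≡⟨ cong₂ _+_
             (trans (sum-lookup (layer n j) (λ v → δ v (proj₁ (lookup E i)) * δ v (proj₁ (lookup E i′)))) (∑-layer-δδ _ _ (proj₁ (edge-ranks (∈-lookup i)))))
             (trans (sum-lookup (layer n (suc j)) (λ v → δ v (proj₂ (lookup E i)) * δ v (proj₂ (lookup E i′)))) (∑-layer-δδ _ _ (proj₂ (edge-ranks (∈-lookup i))))) ⟩
      δ (proj₁ (lookup E i)) (proj₁ (lookup E i′)) + δ (proj₂ (lookup E i)) (proj₂ (lookup E i′)) ∎
      where open ≡-Reasoning

    line-entry : ∀ x i i′ → scalar x i i′ - adjacencyMatrix (lineGraph Γ) i i′ ≡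
      scalar (x + (+ 2)) i i′ - sum (λ l → incidence i l * incidenceᵀ l i′)
    line-entry x i i′ = begin
      scalar x i i′ - M
        ≡⟨ cong (_- M) (scalar-lookup _≟ᵉ_ (Graph.unique (lineGraph Γ)) x i i′) ⟩
      x * d - M
        ≡⟨ shift x d M ⟩
      (x + (+ 2)) * d - (M + (+ 2) * d)
        ≡⟨ cong₂ _-_ (sym (scalar-lookup _≟ᵉ_ (Graph.unique (lineGraph Γ)) (x + (+ 2)) i i′))
             (trans (adjacency-entry (∈-lookup i) (∈-lookup i′)) (sym (edge-gram i i′))) ⟩
      scalar (x + (+ 2)) i i′ - sum (λ l → incidence i l * incidenceᵀ l i′) ∎
      where
      open ≡-Reasoning
      M = adjacencyMatrix (lineGraph Γ) i i′
      d = 𝟙 (lookup E i ≟ᵉ lookup E i′)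
      shift : ∀ x d a → x * d - a ≡ (x + (+ 2)) * d - (a + (+ 2) * d)
      shift = solve-∀

  scalar-≢ : ∀ t {i l : Fin n} → i ≢ l → scalar t i l ≡ 0ℤ
  scalar-≢ t {i} {l} i≢l with i Fin.≟ l
  ... | yes i≡l = contradiction i≡l i≢l
  ... | no _    = refl

  scalar-injective : ∀ t (h : Fin o → Fin n) → (∀ {i l} → h i ≡ h l → i ≡ l) → ∀ i l → scalar t (h i) (h l) ≡ scalar t i l
  scalar-injective t h h-inj i l with i Fin.≟ l | h i Fin.≟ h l
  ... | yes _    | yes _     = refl
  ... | yes i≡l  | no hi≢hl  = contradiction (cong h i≡l) hi≢hl
  ... | no i≢l   | yes hi≡hl = contradiction (h-inj hi≡hl) i≢l
  ... | no _     | no _      = refl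

  -- The middle layers, n = 2 j + 1 and k = j + 1.

  module _ (j : ℕ) where
    private
      N C : ℕ
      N = suc (2 ℕ.* j)
      C = N Comb.C suc j
      open Layers N j

      -- Equal layer sizes, needed for the powers of y to cancel in `bipartite-det`.
      middle : N Comb.C j ≡ C
      middle = trans (nCk≡nC[n∸k] (ℕ.m≤n⇒m≤1+n (ℕ.m≤m+n j (j ℕ.+ 0)))) (cong (N Comb.C_) (N∸j j))
        where
        N∸j : ∀ j → suc (2 ℕ.* j) ℕ.∸ j ≡ suc j
        N∸j j = trans (cong (ℕ._∸ j) (trans (cong (λ z → suc (j ℕ.+ z)) (ℕ.+-identityʳ j)) (sym (ℕ.+-suc j j)))) (ℕ.m+n∸m≡n j (suc j))

      -- Lower vertices have degree n - j and upper ones j + 1. Their equality lets t = y + k reduce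
      -- both diagonal blocks of `vertex-entry` to y I.
      degree : + N - + j ≡ + suc j
      degree = trans (cong (λ z → 1ℤ + z - + j) (ℤ.pos-* 2 j)) (simplify (+ j))
        where
        simplify : ∀ j → 1ℤ + (+ 2) * j - j ≡ 1ℤ + j
        simplify = solve-∀

    vertex-entry : ∀ y l l′ → scalar (y + + suc j) l l′ - sum (λ e → incidenceᵀ l e * incidence e l′) ≡
      block (scalar y) (λ u w → - coverMat u w) (λ w u → - coverMat u w) (scalar y) l l′
    vertex-entry y = ++-elim {a} {b} _
      (λ u → ++-elim {a} {b} _ (λ u′ → left-left u u′) (λ w′ → left-right u w′))
      (λ w → ++-elim {a} {b} _ (λ u′ → right-left w u′) (λ w′ → right-right w w′))
      where
      open ≡-Reasoning
      k = + suc j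
      t = y + k
      Aᵀ = λ u w → - coverMat u w
      Bᵀ = λ w u → - coverMat u w
      incᵀˡ : ∀ u e → incidenceᵀ (u ↑ˡ b) e ≡ lowerEnd e u
      incᵀˡ u = cong-app (++-↑ˡ (λ l e → lowerEnd e l) (λ l e → upperEnd e l) u)
      incᵀʳ : ∀ w e → incidenceᵀ (a ↑ʳ w) e ≡ upperEnd e w
      incᵀʳ w = cong-app (++-↑ʳ (λ l e → lowerEnd e l) (λ l e → upperEnd e l) w)
      incˡ : ∀ u e → incidence e (u ↑ˡ b) ≡ lowerEnd e u
      incˡ u e = ++-↑ˡ (lowerEnd e) (upperEnd e) u
      incʳ : ∀ w e → incidence e (a ↑ʳ w) ≡ upperEnd e w
      incʳ w e = ++-↑ʳ (lowerEnd e) (upperEnd e) w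
      lo : Fin a → Subset N
      lo = lookup (layer N j)
      hi : Fin b → Subset N
      hi = lookup (layer N (suc j))
      distrib : ∀ y k d → (y + k) * d - k * d ≡ y * d
      distrib = solve-∀
      left-left : ∀ u u′ → scalar t (u ↑ˡ b) (u′ ↑ˡ b) - sum (λ e → incidenceᵀ (u ↑ˡ b) e * incidence e (u′ ↑ˡ b))
        ≡ block (scalar y) Aᵀ Bᵀ (scalar y) (u ↑ˡ b) (u′ ↑ˡ b)
      left-left u u′ = begin
        scalar t (u ↑ˡ b) (u′ ↑ˡ b) - sum (λ e → incidenceᵀ (u ↑ˡ b) e * incidence e (u′ ↑ˡ b))
          ≡⟨ cong₂ _-_ (scalar-injective t (_↑ˡ b) (Fin.↑ˡ-injective b _ _) u u′)
               (trans (sum-cong-≗ λ e → cong₂ _*_ (incᵀˡ u e) (incˡ u′ e))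
                 (trans (sum-lookup E (λ e → δ (lo u) (proj₁ e) * δ (lo u′) (proj₁ e)))
                   (trans (∑-lower-lower (lo u) (lo u′) (lookup-layer N j u)) (cong (_* δ (lo u) (lo u′)) degree)))) ⟩
        scalar t u u′ - k * δ (lo u) (lo u′)
          ≡⟨ cong (_- k * δ (lo u) (lo u′)) (scalar-lookup _≟ˢ_ (layer-unique N j) t u u′) ⟩
        t * δ (lo u) (lo u′) - k * δ (lo u) (lo u′)
          ≡⟨ distrib y k (δ (lo u) (lo u′)) ⟩
        y * δ (lo u) (lo u′)
          ≡⟨ scalar-lookup _≟ˢ_ (layer-unique N j) y u u′ ⟨
        scalar y u u′
          ≡⟨ trans (cong-app (++-↑ˡ (beside (scalar y) Aᵀ) (beside Bᵀ (scalar y)) u) (u′ ↑ˡ b)) (++-↑ˡ (scalar y u) (Aᵀ u) u′) ⟨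
        block (scalar y) Aᵀ Bᵀ (scalar y) (u ↑ˡ b) (u′ ↑ˡ b) ∎
      left-right : ∀ u w′ → scalar t (u ↑ˡ b) (a ↑ʳ w′) - sum (λ e → incidenceᵀ (u ↑ˡ b) e * incidence e (a ↑ʳ w′))
        ≡ block (scalar y) Aᵀ Bᵀ (scalar y) (u ↑ˡ b) (a ↑ʳ w′)
      left-right u w′ = begin
        scalar t (u ↑ˡ b) (a ↑ʳ w′) - sum (λ e → incidenceᵀ (u ↑ˡ b) e * incidence e (a ↑ʳ w′))
          ≡⟨ cong₂ _-_ (scalar-≢ t (↑ˡ≢↑ʳ u w′))
               (trans (sum-cong-≗ λ e → cong₂ _*_ (incᵀˡ u e) (incʳ w′ e))
                 (trans (sum-lookup E (λ e → δ (lo u) (proj₁ e) * δ (hi w′) (proj₂ e)))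
                   (∑-lower-upper (lo u) (hi w′) (lookup-layer N j u) (lookup-layer N (suc j) w′)))) ⟩
        0ℤ - coverMat u w′
          ≡⟨ ℤ.+-identityˡ (- coverMat u w′) ⟩
        - coverMat u w′
          ≡⟨ trans (cong-app (++-↑ˡ (beside (scalar y) Aᵀ) (beside Bᵀ (scalar y)) u) (a ↑ʳ w′)) (++-↑ʳ (scalar y u) (Aᵀ u) w′) ⟨
        block (scalar y) Aᵀ Bᵀ (scalar y) (u ↑ˡ b) (a ↑ʳ w′) ∎
      right-left : ∀ w u′ → scalar t (a ↑ʳ w) (u′ ↑ˡ b) - sum (λ e → incidenceᵀ (a ↑ʳ w) e * incidence e (u′ ↑ˡ b))
        ≡ block (scalar y) Aᵀ Bᵀ (scalar y) (a ↑ʳ w) (u′ ↑ˡ b)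
      right-left w u′ = begin
        scalar t (a ↑ʳ w) (u′ ↑ˡ b) - sum (λ e → incidenceᵀ (a ↑ʳ w) e * incidence e (u′ ↑ˡ b))
          ≡⟨ cong₂ _-_ (scalar-≢ t (↑ˡ≢↑ʳ u′ w ∘ sym))
               (trans (sum-cong-≗ λ e → trans (cong₂ _*_ (incᵀʳ w e) (incˡ u′ e)) (ℤ.*-comm (upperEnd e w) (lowerEnd e u′)))
                 (trans (sum-lookup E (λ e → δ (lo u′) (proj₁ e) * δ (hi w) (proj₂ e)))
                   (∑-lower-upper (lo u′) (hi w) (lookup-layer N j u′) (lookup-layer N (suc j) w)))) ⟩
        0ℤ - coverMat u′ w
          ≡⟨ ℤ.+-identityˡ (- coverMat u′ w) ⟩
        - coverMat u′ w
          ≡⟨ trans (cong-app (++-↑ʳ (beside (scalar y) Aᵀ) (beside Bᵀ (scalar y)) w) (u′ ↑ˡ b)) (++-↑ˡ (Bᵀ w) (scalar y w) u′) ⟨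
        block (scalar y) Aᵀ Bᵀ (scalar y) (a ↑ʳ w) (u′ ↑ˡ b) ∎
      right-right : ∀ w w′ → scalar t (a ↑ʳ w) (a ↑ʳ w′) - sum (λ e → incidenceᵀ (a ↑ʳ w) e * incidence e (a ↑ʳ w′))
        ≡ block (scalar y) Aᵀ Bᵀ (scalar y) (a ↑ʳ w) (a ↑ʳ w′)
      right-right w w′ = begin
        scalar t (a ↑ʳ w) (a ↑ʳ w′) - sum (λ e → incidenceᵀ (a ↑ʳ w) e * incidence e (a ↑ʳ w′))
          ≡⟨ cong₂ _-_ (scalar-injective t (a ↑ʳ_) (Fin.↑ʳ-injective a _ _) w w′)
               (trans (sum-cong-≗ λ e → cong₂ _*_ (incᵀʳ w e) (incʳ w′ e))
                 (trans (sum-lookup E (λ e → δ (hi w) (proj₂ e) * δ (hi w′) (proj₂ e)))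
                   (∑-upper-upper (hi w) (hi w′) (lookup-layer N (suc j) w)))) ⟩
        scalar t w w′ - k * δ (hi w) (hi w′)
          ≡⟨ cong (_- k * δ (hi w) (hi w′)) (scalar-lookup _≟ˢ_ (layer-unique N (suc j)) t w w′) ⟩
        t * δ (hi w) (hi w′) - k * δ (hi w) (hi w′)
          ≡⟨ distrib y k (δ (hi w) (hi w′)) ⟩
        y * δ (hi w) (hi w′)
          ≡⟨ scalar-lookup _≟ˢ_ (layer-unique N (suc j)) y w w′ ⟨
        scalar y w w′
          ≡⟨ trans (cong-app (++-↑ʳ (beside (scalar y) Aᵀ) (beside Bᵀ (scalar y)) w) (a ↑ʳ w′)) (++-↑ʳ (Bᵀ w) (scalar y w) w′) ⟨
        block (scalar y) Aᵀ Bᵀ (scalar y) (a ↑ʳ w) (a ↑ʳ w′) ∎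

    -- The Schur complement with s = t = y; the signs of the two off-diagonal blocks cancel in their
    -- product.
    bipartite-det : ∀ y → y ≢ 0ℤ →
      detℤ (block (scalar y) (λ u w → - coverMat u w) (λ w u → - coverMat u w) (scalar y)) ≡ upDet N j (y * y)
    bipartite-det y y≢0 = cancel-^ a y≢0 (begin
      y ^ a * detℤ (block (scalar y) (λ u w → - coverMat u w) (λ w u → - coverMat u w) (scalar y))
        ≡⟨ schurˡ y y (λ u w → - coverMat u w) (λ w u → - coverMat u w) ⟩
      y ^ b * detℤ (λ u u′ → scalar (y * y) u u′ - sum (λ w → - coverMat u w * - coverMat u′ w))
        ≡⟨ cong₂ (λ l z → y ^ l * z) (sym a≡b) (det-cong λ u u′ → cong (λ z → scalar (y * y) u u′ - z)
             (sum-cong-≗ λ w → signs (coverMat u w) (coverMat u′ w))) ⟩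
      y ^ a * upDet N j (y * y) ∎)
      where
      open ≡-Reasoning
      signs : ∀ c d → - c * - d ≡ c * d
      signs = solve-∀
      a≡b : a ≡ b
      a≡b = trans (length-layer N j) (trans middle (sym (length-layer N (suc j))))

    -- The exponent is the surplus of edges over vertices, (j + 1) C - 2 C, where C is the size of
    -- either layer. `1 ≤ j` ensures that this equals the truncated (j ∸ 1) C.
    line-det : ∀ {x y} → x + (+ 2) ≡ y + + suc j → y ≢ 0ℤ → x + (+ 2) ≢ 0ℤ → 1 ℕ.≤ j →
      detℤ (λ i i′ → scalar x i i′ - adjacencyMatrix (lineGraph Γ) i i′) ≡
      (x + (+ 2)) ^ ((j ℕ.∸ 1) ℕ.* (N Comb.C j)) * upDet N j (y * y)
    line-det {x} {y} t≡ y≢0 t≢0 1≤j = cancel-^ (a ℕ.+ b) t≢0 (begin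
      t ^ (a ℕ.+ b) * detℤ (λ i i′ → scalar x i i′ - adjacencyMatrix (lineGraph Γ) i i′)
        ≡⟨ cong (t ^ (a ℕ.+ b) *_) (det-cong (line-entry x)) ⟩
      t ^ (a ℕ.+ b) * detℤ (λ i i′ → scalar t i i′ - sum (λ l → incidence i l * incidenceᵀ l i′))
        ≡⟨ sylvester t incidence incidenceᵀ ⟩
      t ^ m * detℤ (λ l l′ → scalar t l l′ - sum (λ e → incidenceᵀ l e * incidence e l′))
        ≡⟨ cong (t ^ m *_) (trans (det-cong λ l l′ → trans
             (cong (λ s → scalar s l l′ - sum (λ e → incidenceᵀ l e * incidence e l′)) t≡) (vertex-entry y l l′))
             (bipartite-det y y≢0)) ⟩
      t ^ m * upDet N j (y * y)
        ≡⟨ cong (λ l → t ^ l * upDet N j (y * y)) m≡ ⟩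
      t ^ (a ℕ.+ b ℕ.+ (j ℕ.∸ 1) ℕ.* (N Comb.C j)) * upDet N j (y * y)
        ≡⟨ trans (cong (_* upDet N j (y * y)) (ℤ.^-distribˡ-+-* t (a ℕ.+ b) ((j ℕ.∸ 1) ℕ.* (N Comb.C j))))
             (ℤ.*-assoc (t ^ (a ℕ.+ b)) (t ^ ((j ℕ.∸ 1) ℕ.* (N Comb.C j))) (upDet N j (y * y))) ⟩
      t ^ (a ℕ.+ b) * (t ^ ((j ℕ.∸ 1) ℕ.* (N Comb.C j)) * upDet N j (y * y)) ∎)
      where
      open ≡-Reasoning
      t = x + (+ 2)
      count : ∀ j C → 1 ℕ.≤ j → suc j ℕ.* C ≡ C ℕ.+ C ℕ.+ (j ℕ.∸ 1) ℕ.* C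
      count (suc i) C _ = sym (ℕ.+-assoc C C (i ℕ.* C))
      m≡ : m ≡ a ℕ.+ b ℕ.+ (j ℕ.∸ 1) ℕ.* (N Comb.C j)
      m≡ = begin
        m
          ≡⟨ ℤ.+-injective (trans length-edges (sym (ℤ.pos-* (suc j) C))) ⟩
        suc j ℕ.* C
          ≡⟨ count j C 1≤j ⟩
        C ℕ.+ C ℕ.+ (j ℕ.∸ 1) ℕ.* C
          ≡⟨ cong₂ ℕ._+_ (cong₂ ℕ._+_ (trans (length-layer N j) middle) (length-layer N (suc j))) (cong ((j ℕ.∸ 1) ℕ.*_) middle) ⟨
        a ℕ.+ b ℕ.+ (j ℕ.∸ 1) ℕ.* (N Comb.C j) ∎

  -- x - (i - 2) = y + (k - i) and x - (2k - i - 2) = y - (k - i), where x + 2 = y + k.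
  eigenvalue-pairs : ∀ {x y k : ℤ} n m → x + (+ 2) ≡ y + k →
    ∏< m (λ i → (x - (+ i - + 2)) ^ multiplicity n i) * ∏< m (λ i → (x - ((+ 2) * k - + i - + 2)) ^ multiplicity n i) ≡
    ∏< m (λ i → (y * y - (k - + i) * (k - + i)) ^ multiplicity n i)
  eigenvalue-pairs {x} {y} {k} n m eq = trans (∏<-* m _ _) (∏<-cong m λ i → trans
    (sym (^-distribʳ-* (x - (+ i - + 2)) (x - ((+ 2) * k - + i - + 2)) (multiplicity n i)))
    (cong (_^ multiplicity n i) (trans (group x k (+ i)) (trans (cong (λ t → (t - + i) * (t - (+ 2) * k + + i)) eq) (square y k (+ i))))))
    where
    group : ∀ x k i → (x - (i - + 2)) * (x - ((+ 2) * k - i - + 2)) ≡ (x + (+ 2) - i) * (x + (+ 2) - (+ 2) * k + i)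
    group = solve-∀
    square : ∀ y k i → (y + k - i) * (y + k - (+ 2) * k + i) ≡ y * y - (k - i) * (k - i)
    square = solve-∀

-- Comparison with the listed eigenvalues.

module Spectrum where

  open Determinant
  open Evaluation
  open BooleanLattice
  open LayerSpectrum
  open LineGraph
  open import Data.Integer.Base using (ℤ; +_; 0ℤ; 1ℤ; _+_; _*_; _-_; -_; _^_)
  open import Data.List.Base using (map; concatMap; replicate; upTo)

  odd : ℕ → ℕ
  odd h = suc (2 ℕ.* h)

  eigenvalues : ℕ → List ℤ
  eigenvalues h =
    replicate ((h ℕ.∸ 1) ℕ.* (odd h Comb.C h) ℕ.+ 1) (- (+ 2)) List.++
    concatMap (λ i → replicate (multiplicity (odd h) i) (+ i - + 2)) (map suc (upTo h)) List.++
    concatMap (λ i → replicate (multiplicity (odd h) i) (+ 2 * + suc h - + i - + 2)) (upTo (suc h))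

  eval-eigenvalues : ∀ h {x y} → x + (+ 2) ≡ y + + suc h →
    eval (fromRoots (eigenvalues h)) x ≡
    (x + (+ 2)) ^ ((h ℕ.∸ 1) ℕ.* (odd h Comb.C h)) *
    ∏< (suc h) (λ i → (y * y - (+ suc h - + i) * (+ suc h - + i)) ^ multiplicity (odd h) i)
  eval-eigenvalues h {x} {y} t≡ = begin
    eval (fromRoots (eigenvalues h)) x
      ≡⟨ eval-fromRoots x (eigenvalues h) ⟩
    rootProduct x (eigenvalues h)
      ≡⟨ trans (∏-++ x (replicate (e ℕ.+ 1) (- (+ 2))) _) (cong₂ _*_ (∏-replicate x (e ℕ.+ 1) (- (+ 2)))
           (∏-++ x (concatMap (λ i → replicate (M i) (+ i - + 2)) (map suc (upTo h))) _)) ⟩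
    t ^ (e ℕ.+ 1) * (rootProduct x (concatMap (λ i → replicate (M i) (+ i - + 2)) (map suc (upTo h)))
      * rootProduct x (concatMap (λ i → replicate (M i) (+ 2 * + suc h - + i - + 2)) (upTo (suc h))))
      ≡⟨ cong₂ (λ u v → t ^ (e ℕ.+ 1) * (u * v))
           (trans (cong (rootProduct x) (List.concatMap-map (λ i → replicate (M i) (+ i - + 2)) suc (upTo h)))
             (∏-concatMap-upTo x h (λ i → M (suc i)) (λ i → + suc i - + 2)))
           (∏-concatMap-upTo x (suc h) M (λ i → + 2 * + suc h - + i - + 2)) ⟩
    t ^ (e ℕ.+ 1) * (∏< h (F ∘ suc) * ∏< (suc h) G)
      ≡⟨ cong (_* (∏< h (F ∘ suc) * ∏< (suc h) G)) (ℤ.^-distribˡ-+-* t e 1) ⟩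
    t ^ e * t ^ 1 * (∏< h (F ∘ suc) * ∏< (suc h) G)
      ≡⟨ regroup (t ^ e) (t ^ 1) (∏< h (F ∘ suc)) (∏< (suc h) G) ⟩
    t ^ e * (t ^ 1 * ∏< h (F ∘ suc) * ∏< (suc h) G)
      -- The extra copy of -2 is the missing index 0 of the family i - 2: `F 0` is x + 2 to the
      -- power C(n, 0) = 1. With it both families run over the same indices and can be paired.
      ≡⟨ cong (λ z → t ^ e * (z * ∏< (suc h) G)) (trans (cong (λ m → t ^ m * ∏< h (F ∘ suc)) (sym (nC0≡1 (odd h)))) (sym (∏<-head h F))) ⟩
    t ^ e * (∏< (suc h) F * ∏< (suc h) G)
      ≡⟨ cong (t ^ e *_) (eigenvalue-pairs {x} {y} (odd h) (suc h) t≡) ⟩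
    t ^ e * ∏< (suc h) (λ i → (y * y - (+ suc h - + i) * (+ suc h - + i)) ^ M i) ∎
    where
    open ≡-Reasoning
    e = (h ℕ.∸ 1) ℕ.* (odd h Comb.C h)
    t = x + (+ 2)
    M = multiplicity (odd h)
    F G : ℕ → ℤ
    F i = (x - (+ i - + 2)) ^ M i
    G i = (x - (+ 2 * + suc h - + i - + 2)) ^ M i
    regroup : ∀ a b c d → a * b * (c * d) ≡ a * (b * c * d)
    regroup = solve-∀

  spectrum : ∀ h → 1 ℕ.≤ h → HasSpectrum (lineGraph (BLlayers (odd h) (suc h))) (eigenvalues h)
  -- x ≥ 2k gives y = x + 2 - k > k, so that t, y and every y² - c² with c ≤ k are non-zero.
  spectrum h 1≤h = eventually-equal⇒≈ (k ℕ.+ k) (charPoly adj) (fromRoots (eigenvalues h)) agree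
    where
    open ≡-Reasoning
    k = suc h
    adj = adjacencyMatrix (lineGraph (BLlayers (odd h) k))
    agree : ∀ x → k ℕ.+ k ℕ.≤ x → eval (charPoly adj) (+ x) ≡ eval (fromRoots (eigenvalues h)) (+ x)
    agree x 2k≤x = begin
      eval (charPoly adj) (+ x)
        ≡⟨ eval-charPoly (+ x) adj ⟩
      detℤ (λ i i′ → scalar (+ x) i i′ - adj i i′)
        ≡⟨ line-det h {y = y} t≡ (λ y≡0 → ℕ.m<n⇒n≢0 k<Y (ℤ.+-injective y≡0)) (λ t≡0 → ℕ.m+1+n≢0 x (ℤ.+-injective t≡0)) 1≤h ⟩
      t ^ e * upDet (odd h) h (y * y)
        -- The top layer j = h has d = 0, so the recursion starts from y² written as y² - 0².
        ≡⟨ cong (λ z → t ^ e * z) (trans (cong (upDet (odd h) h) (sym (ℤ.+-identityʳ (y * y)))) (upDet-product k<Y h 0 (ℕ.+-identityʳ h))) ⟩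
      t ^ e * ∏< k (λ i → (y * y - (+ k - + i) * (+ k - + i)) ^ multiplicity (odd h) i)
        ≡⟨ eval-eigenvalues h {y = y} t≡ ⟨
      eval (fromRoots (eigenvalues h)) (+ x) ∎
      where
      Y = x ℕ.+ 2 ℕ.∸ k
      y t : ℤ
      y = + Y
      t = + x + + 2
      e = (h ℕ.∸ 1) ℕ.* (odd h Comb.C h)
      k<Y : k ℕ.< Y
      k<Y = ℕ.m+n≤o⇒m≤o∸n (suc k) (ℕ.≤-trans (ℕ.s≤s 2k≤x) (ℕ.≤-trans (ℕ.n≤1+n _) (ℕ.≤-reflexive (ℕ.+-comm 2 x))))
      t≡ : t ≡ y + + k
      t≡ = cong (λ m → + m) (sym (ℕ.m∸n+n≡m (ℕ.≤-trans (ℕ.m≤m+n k k) (ℕ.≤-trans 2k≤x (ℕ.m≤m+n x 2)))))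

open Spectrum using (spectrum)

open import Data.Nat using (ℕ; suc; _+_; _*_; _∸_; _≤_)
open import Data.Integer as ℤ using (ℤ; +_; -[1+_])
open import Data.List using (List; _++_; map; concatMap; replicate; upTo)

theorem3p4 : (k n : ℕ) → 2 ≤ k → n ≡ 2 * k ∸ 1 →
    HasSpectrum (lineGraph (BLlayers n k))
    (  replicate ((k ∸ 2) * binom n (+ k ℤ.- + 1) + 1) (ℤ.- (+ 2))
    ++ concatMap (λ i → replicate (binom n (+ i) ∸ binom n (+ i ℤ.- + 1)) (+ i ℤ.- + 2)) (map suc (upTo (k ∸ 1)))
    ++ concatMap (λ i → replicate (binom n (+ i) ∸ binom n (+ i ℤ.- + 1)) (+ 2 ℤ.* + k ℤ.- + i ℤ.- + 2)) (upTo k))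
-- Here k - 1 = `suc h`. The number `2 * k ∸ 1` computes to `suc h + suc (suc h + 0)`, and one
-- `+-suc` makes it `odd (suc h)`; after that the stated list and `eigenvalues (suc h)` agree by
-- computation.
theorem3p4 (suc (suc h)) n (ℕ.s≤s (ℕ.s≤s _)) n≡ with refl ← trans n≡ (ℕ.+-suc (suc h) (suc h + 0)) = spectrum (suc h) (ℕ.s≤s ℕ.z≤n)
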